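{- For any positive integer $q$ and any integers $p,m\ge 2$, the following two identities hold: $$\sum_{\substack{i+j=m-1\\ i,j\ge 0}}\binom{p+i-1}{i}\binom{q+j-1}{j}\zeta(p+i,q+j)-(-1)^q\sum_{\substack{i+j=p-1\\ i,j\ge 0}}\binom{m+i-1}{i}\binom{q+j-1}{j}\zeta(m+i,q+j)$$ $$=\sum_{\substack{i+j=q-1\\ i,j\ge 0}}(-1)^j\binom{m+i-1}{i}\binom{p+j-1}{j}\zeta(m+i)\zeta(p+j),$$ and $$\sum_{\substack{i+j=m-1\\ i,j\ge 0}}\binom{p+i-1}{i}\binom{q+j-1}{j}T(p+i,q+j)-(-1)^q\sum_{\substack{i+j=p-1\\ i,j\ge 0}}\binom{m+i-1}{i}\binom{q+j-1}{j}T(m+i,q+j)$$ $$=\sum_{\substack{i+j=q-1\\ i,j\ge 0}}(-1)^j\binom{m+i-1}{i}\binom{p+j-1}{j}T(m+i)T(p+j).$$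
   Context: For positive integers $k_1,\ldots,k_r$ with $k_1>1$, the multiple zeta values and multiple $T$-values are $$\zeta(k_1,\ldots,k_r)=\sum_{n_1>\cdots>n_r>0}\frac{1}{n_1^{k_1}\cdots n_r^{k_r}},\qquad T(k_1,\ldots,k_r)=\sum_{\substack{n_1>\cdots>n_r>0\\ n_j\equiv r+1-j\ (\mathrm{mod}\ 2)}}\frac{2^r}{n_1^{k_1}\cdots n_r^{k_r}}.$$ -}

module Defs where

open import Data.Bool.Base using (true; false; if_then_else_)
open import Data.Integer.Base as ℤ using (ℤ; +_)
import Data.Integer.Properties as ℤP
open import Data.List.Base using (List; []; _∷_; length)
open import Data.List.Relation.Unary.All using (All; []; _∷_)
open import Data.Nat.Base as ℕ using (ℕ; zero; suc; NonZero; NonTrivial)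
open import Data.Nat.DivMod using (_%_)
import Data.Nat.Properties as ℕP
open import Data.Product.Base using (∃; _×_; _,_)
open import Data.Rational.Base
  hiding (NonZero; ≢-nonZero; >-nonZero; <-nonZero; _≃_)
open import Data.Rational.Properties
import Data.Rational.Unnormalised.Base as ℚᵘ
import Data.Rational.Unnormalised.Properties as ℚᵘP
open import Data.Rational.Solver using (module +-*-Solver)
open import Data.Sum.Base using ([_,_]′)
open import Relation.Binary.PropositionalEquality
  using (_≡_; refl; sym; trans; cong; cong₂; subst; subst₂)
open import Relation.Nullary.Decidable using (does; yes; no)
open import Relation.Nullary.Negation using (contradiction)
open +-*-Solver

------------------------------------------------------------------------
-- Ordered-field facts about ℚ

*-monoˡ : ∀ {p q r} → 0ℚ ≤ p → q ≤ r → p * q ≤ p * r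
*-monoˡ {p} 0≤p = *-monoˡ-≤-nonNeg p {{nonNegative 0≤p}}

*-monoʳ : ∀ {p q r} → 0ℚ ≤ p → q ≤ r → q * p ≤ r * p
*-monoʳ {p} 0≤p = *-monoʳ-≤-nonNeg p {{nonNegative 0≤p}}

0≤* : ∀ {p q} → 0ℚ ≤ p → 0ℚ ≤ q → 0ℚ ≤ p * q
0≤* {p} {q} 0≤p 0≤q = subst (_≤ p * q) (*-zeroʳ p) (*-monoˡ 0≤p 0≤q)

0<* : ∀ {p q} → 0ℚ < p → 0ℚ < q → 0ℚ < p * q
0<* {p} {q} 0<p 0<q =
  subst (_< p * q) (*-zeroʳ p) (*-monoʳ-<-pos p {{positive 0<p}} 0<q)

p≤p+q : ∀ {p q} → 0ℚ ≤ q → p ≤ p + q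
p≤p+q {p} {q} 0≤q = subst (_≤ p + q) (+-identityʳ p) (+-monoʳ-≤ p 0≤q)

0≤+ : ∀ {p q} → 0ℚ ≤ p → 0ℚ ≤ q → 0ℚ ≤ p + q
0≤+ 0≤p 0≤q = ≤-trans 0≤p (p≤p+q 0≤q)

0≤q-p : ∀ {p q} → p ≤ q → 0ℚ ≤ q - p
0≤q-p {p} {q} p≤q = subst (_≤ q - p) (+-inverseʳ p) (+-monoˡ-≤ (- p) p≤q)

0≤1 : 0ℚ ≤ 1ℚ
0≤1 = <⇒≤ (positive⁻¹ 1ℚ)

halve : ∀ ε → 0ℚ < ε → ∃ λ δ → 0ℚ < δ × δ + δ ≡ ε
halve ε 0<ε = ½ * ε , 0<* (positive⁻¹ ½) 0<ε ,
  solve 1 (λ e → con ½ :* e :+ con ½ :* e := e) refl ε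

divide : ∀ b ε → 0ℚ < b → 0ℚ < ε → ∃ λ δ → 0ℚ < δ × b * δ ≡ ε
divide b ε 0<b 0<ε = 1/b * ε , 0<* (positive⁻¹ 1/b {{1/pos⇒pos b}}) 0<ε ,
  trans (sym (*-assoc b 1/b ε))
        (trans (cong (_* ε) (*-inverseʳ b)) (*-identityˡ ε))
  where
  instance
    b-pos     = positive 0<b
    b-nonZero = pos⇒nonZero b
  1/b = 1/ b

square-cancel-< : ∀ {p q} → 0ℚ ≤ q → p * p < q * q → p < q
square-cancel-< {p} {q} 0≤q p²<q² with p <? q
... | yes p<q = p<q
... | no  p≮q = contradiction p²<q²
  (λ lt → <-irrefl refl (<-≤-trans lt
    (≤-trans (*-monoˡ 0≤q (≮⇒≥ p≮q)) (*-monoʳ (≤-trans 0≤q (≮⇒≥ p≮q)) (≮⇒≥ p≮q)))))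

negate-difference : ∀ p q → - (p - q) ≡ q - p
negate-difference = solve 2 (λ a b → :- (a :- b) := b :- a) refl

∣p-q∣≡∣q-p∣ : ∀ p q → ∣ p - q ∣ ≡ ∣ q - p ∣
∣p-q∣≡∣q-p∣ p q = trans (sym (∣-p∣≡∣p∣ (p - q))) (cong ∣_∣ (negate-difference p q))

triangle : ∀ p q {r} → p + q ≡ r → ∣ r ∣ ≤ ∣ p ∣ + ∣ q ∣
triangle p q refl = ∣p+q∣≤∣p∣+∣q∣ p q

+-cancel : ∀ p q → (p - q) + q ≡ p
+-cancel = solve 2 (λ a b → (a :- b) :+ b := a) refl

+-rearrange : ∀ p q r s → (p - q) + (r - s) ≡ (p + r) - (q + s)
+-rearrange = solve 4 (λ a b c d → (a :- b) :+ (c :- d) := (a :+ c) :- (b :+ d)) refl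

*-rearrange : ∀ p q r s → p * (r - s) + s * (p - q) ≡ p * r - q * s
*-rearrange = solve 4
  (λ a b c d → a :* (c :- d) :+ d :* (a :- b) := a :* c :- b :* d) refl

toℚᵘ-/ : ∀ i d .{{_ : NonZero d}} → toℚᵘ (i / d) ℚᵘ.≃ (i ℚᵘ./ d)
toℚᵘ-/ i (suc d) = toℚᵘ-fromℚᵘ (ℚᵘ.mkℚᵘ i d)

/-mono-≤ : ∀ a b c d .{{_ : NonZero b}} .{{_ : NonZero d}} →
           a ℕ.* d ℕ.≤ c ℕ.* b → + a / b ≤ + c / d
/-mono-≤ a b@(suc _) c d@(suc _) ad≤cb = toℚᵘ-cancel-≤
  (ℚᵘP.≤-respˡ-≃ (ℚᵘP.≃-sym (toℚᵘ-/ (+ a) b))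
  (ℚᵘP.≤-respʳ-≃ (ℚᵘP.≃-sym (toℚᵘ-/ (+ c) d))
  (ℚᵘ.*≤* (subst₂ ℤ._≤_ (ℤP.pos-* a d) (ℤP.pos-* c b) (ℤ.+≤+ ad≤cb)))))

/-*-/ : ∀ a b c d .{{_ : NonZero b}} .{{_ : NonZero d}} .{{_ : NonZero (b ℕ.* d)}} →
        (+ a / b) * (+ c / d) ≡ + (a ℕ.* c) / (b ℕ.* d)
/-*-/ a b@(suc _) c d@(suc _) = toℚᵘ-injective
  (ℚᵘP.≃-trans (toℚᵘ-homo-* (+ a / b) (+ c / d))
  (ℚᵘP.≃-trans (ℚᵘP.*-cong (toℚᵘ-/ (+ a) b) (toℚᵘ-/ (+ c) d))
  (ℚᵘP.≃-trans (ℚᵘP.≃-reflexive (cong (λ z → z ℚᵘ./ (b ℕ.* d)) (sym (ℤP.pos-* a c))))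
  (ℚᵘP.≃-sym (toℚᵘ-/ (+ (a ℕ.* c)) (b ℕ.* d))))))

/1-+-/1 : ∀ a b → (+ a / 1) + (+ b / 1) ≡ + (a ℕ.+ b) / 1
/1-+-/1 a b = toℚᵘ-injective
  (ℚᵘP.≃-trans (toℚᵘ-homo-+ (+ a / 1) (+ b / 1))
  (ℚᵘP.≃-trans (ℚᵘP.+-cong (toℚᵘ-/ (+ a) 1) (toℚᵘ-/ (+ b) 1))
  (ℚᵘP.≃-trans
    (ℚᵘP.≃-reflexive (cong (λ z → z ℚᵘ./ 1)
      (cong₂ ℤ._+_ (ℤP.*-identityʳ (+ a)) (ℤP.*-identityʳ (+ b)))))
  (ℚᵘP.≃-sym (toℚᵘ-/ (+ (a ℕ.+ b)) 1)))))

------------------------------------------------------------------------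
-- Real numbers as Cauchy sequences of rationals, with _≈_ as equality

IsCauchy : (ℕ → ℚ) → Set
IsCauchy s = ∀ ε → 0ℚ < ε →
  ∃ λ N → ∀ m n → N ℕ.≤ m → N ℕ.≤ n → ∣ s m - s n ∣ < ε

record ℝ : Set where
  constructor mkℝ
  field
    seq      : ℕ → ℚ
    isCauchy : IsCauchy seq

open ℝ public

infix  4 _≈_
infixl 6 _+ᴿ_ _-ᴿ_
infixl 7 _*ᴿ_
infix  8 -ᴿ_

_≈_ : ℝ → ℝ → Set
x ≈ y = ∀ ε → 0ℚ < ε → ∃ λ N → ∀ n → N ℕ.≤ n → ∣ seq x n - seq y n ∣ < ε

fromℚ : ℚ → ℝ
fromℚ p = mkℝ (λ _ → p) λ ε 0<ε →
  0 , λ _ _ _ _ → subst (_< ε) (cong ∣_∣ (sym (+-inverseʳ p))) 0<ε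

fromℤ : ℤ → ℝ
fromℤ i = fromℚ (i / 1)

fromℕ : ℕ → ℝ
fromℕ n = fromℤ (+ n)

+-cauchy : ∀ s t → IsCauchy s → IsCauchy t → IsCauchy (λ n → s n + t n)
+-cauchy s t cs ct ε 0<ε =
  let
    δ , 0<δ , δ+δ≡ε = halve ε 0<ε
    M , hs = cs δ 0<δ
    N , ht = ct δ 0<δ
  in M ℕ.⊔ N , λ m n lm ln →
    subst (∣ (s m + t m) - (s n + t n) ∣ <_) δ+δ≡ε
      (≤-<-trans (triangle (s m - s n) (t m - t n)
          (+-rearrange (s m) (s n) (t m) (t n)))
        (+-mono-< (hs m n (ℕP.m⊔n≤o⇒m≤o M N lm) (ℕP.m⊔n≤o⇒m≤o M N ln))
                  (ht m n (ℕP.m⊔n≤o⇒n≤o M N lm) (ℕP.m⊔n≤o⇒n≤o M N ln))))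

neg-cauchy : ∀ s → IsCauchy s → IsCauchy (λ n → - s n)
neg-cauchy s cs ε 0<ε =
  let N , h = cs ε 0<ε in
  N , λ m n lm ln → subst (_< ε)
    (trans (sym (∣-p∣≡∣p∣ (s m - s n)))
      (cong ∣_∣ (neg-distrib-+ (s m) (- s n))))
    (h m n lm ln)

eventuallyBounded : ∀ s → IsCauchy s →
  ∃ λ b → 0ℚ < b × ∃ λ N → ∀ n → N ℕ.≤ n → ∣ s n ∣ ≤ b
eventuallyBounded s cs =
  let N , h = cs 1ℚ (positive⁻¹ 1ℚ) in
  1ℚ + ∣ s N ∣ , <-≤-trans (positive⁻¹ 1ℚ) (p≤p+q (0≤∣p∣ (s N))) , N , λ n ln →
  ≤-trans (triangle (s n - s N) (s N) (+-cancel (s n) (s N)))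
    (+-monoˡ-≤ ∣ s N ∣ (<⇒≤ (h n N ln ℕP.≤-refl)))

*-cauchy : ∀ s t → IsCauchy s → IsCauchy t → IsCauchy (λ n → s n * t n)
*-cauchy s t cs ct ε 0<ε =
  let
    θ , 0<θ , θ+θ≡ε = halve ε 0<ε
    b , 0<b , K , hb = eventuallyBounded s cs
    c , 0<c , L , hc = eventuallyBounded t ct
    δ , 0<δ , bδ≡θ = divide b θ 0<b 0<θ
    γ , 0<γ , cγ≡θ = divide c θ 0<c 0<θ
    M , hs = cs γ 0<γ
    N , ht = ct δ 0<δ
  in (K ℕ.⊔ L) ℕ.⊔ (M ℕ.⊔ N) , λ m n lm ln →
    let
      lm₁ = ℕP.m⊔n≤o⇒m≤o (K ℕ.⊔ L) (M ℕ.⊔ N) lm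
      lm₂ = ℕP.m⊔n≤o⇒n≤o (K ℕ.⊔ L) (M ℕ.⊔ N) lm
      ln₁ = ℕP.m⊔n≤o⇒m≤o (K ℕ.⊔ L) (M ℕ.⊔ N) ln
      ln₂ = ℕP.m⊔n≤o⇒n≤o (K ℕ.⊔ L) (M ℕ.⊔ N) ln
    in subst (∣ s m * t m - s n * t n ∣ <_) θ+θ≡ε
      (≤-<-trans
        (triangle (s m * (t m - t n)) (t n * (s m - s n))
          (*-rearrange (s m) (s n) (t m) (t n)))
        (+-mono-<
          (product-< (s m) (t m - t n) 0<b bδ≡θ (hb m (ℕP.m⊔n≤o⇒m≤o K L lm₁))
            (ht m n (ℕP.m⊔n≤o⇒n≤o M N lm₂) (ℕP.m⊔n≤o⇒n≤o M N ln₂)))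
          (product-< (t n) (s m - s n) 0<c cγ≡θ (hc n (ℕP.m⊔n≤o⇒n≤o K L ln₁))
            (hs m n (ℕP.m⊔n≤o⇒m≤o M N lm₂) (ℕP.m⊔n≤o⇒m≤o M N ln₂)))))
  where
  product-< : ∀ p d {b δ θ} → 0ℚ < b → b * δ ≡ θ → ∣ p ∣ ≤ b → ∣ d ∣ < δ → ∣ p * d ∣ < θ
  product-< p d {b} 0<b bδ≡θ p≤b d<δ = subst₂ _<_ (sym (∣p*q∣≡∣p∣*∣q∣ p d)) bδ≡θ
    (≤-<-trans (*-monoʳ (0≤∣p∣ d) p≤b) (*-monoʳ-<-pos b {{positive 0<b}} d<δ))

tail-cauchy : ∀ (s b : ℕ → ℚ) → (∀ m n → m ℕ.≤ n → ∣ s n - s m ∣ ≤ b m) →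
  (∀ ε → 0ℚ < ε → ∃ λ N → ∀ n → N ℕ.≤ n → b n < ε) → IsCauchy s
tail-cauchy s b s≤b b→0 ε 0<ε =
  let N , small = b→0 ε 0<ε in
  N , λ m n N≤m N≤n →
    [ (λ m≤n → subst (_< ε) (∣p-q∣≡∣q-p∣ (s n) (s m)) (≤-<-trans (s≤b m n m≤n) (small m N≤m)))
    , (λ n≤m → ≤-<-trans (s≤b n m n≤m) (small n N≤n))
    ]′ (ℕP.≤-total m n)

_+ᴿ_ : ℝ → ℝ → ℝ
x +ᴿ y = mkℝ (λ n → seq x n + seq y n)
  (+-cauchy (seq x) (seq y) (isCauchy x) (isCauchy y))

-ᴿ_ : ℝ → ℝ
-ᴿ x = mkℝ (λ n → - seq x n) (neg-cauchy (seq x) (isCauchy x))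

_-ᴿ_ : ℝ → ℝ → ℝ
x -ᴿ y = x +ᴿ (-ᴿ y)

_*ᴿ_ : ℝ → ℝ → ℝ
x *ᴿ y = mkℝ (λ n → seq x n * seq y n)
  (*-cauchy (seq x) (seq y) (isCauchy x) (isCauchy y))

-- The sum of f i j over all i, j ≥ 0 with i + j = n.

∑[i+j=_] : ℕ → (ℕ → ℕ → ℝ) → ℝ
∑[i+j= zero  ] f = f 0 0
∑[i+j= suc n ] f = f 0 (suc n) +ᴿ ∑[i+j= n ] (λ i j → f (suc i) j)

------------------------------------------------------------------------
-- Truncated multiple sums

-- f 0 + ⋯ + f (N - 1)
sumBelow : ℕ → (ℕ → ℚ) → ℚ
sumBelow zero    f = 0ℚ
sumBelow (suc N) f = sumBelow N f + f N

-- w i n is the numerator contributed by the value n of the i-th summation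
-- variable counted from the innermost one: in a sum over n₁ > ⋯ > n_r the
-- variable n_j has i = r + 1 - j.

Weight : Set
Weight = ℕ → ℕ → ℕ

term : Weight → ℕ → ℕ → ℕ → ℚ
term w i k n = _/_ (+ w i (suc n)) (suc n ℕ.^ k) {{ℕP.m^n≢0 (suc n) k}}

-- The sum of ∏_j w (r + 1 - j) n_j / n_j ^ k_j over N ≥ n₁ > ⋯ > n_r > 0, for
-- ks = k₁ ∷ ⋯ ∷ k_r.  Here n stands for n₁ - 1: n₁ ranges over 1, …, N and the
-- remaining variables are at most n.

truncated : Weight → List ℕ → ℕ → ℚ
truncated w []       N = 1ℚ
truncated w (k ∷ ks) N =
  sumBelow N λ n → term w (length (k ∷ ks)) k n * truncated w ks n

-- k₁ > 1, and k₂, …, k_r positive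

data Admissible : List ℕ → Set where
  instance
    admissible : ∀ {k ks} → {{NonTrivial k}} → {{All NonZero ks}} →
                 Admissible (k ∷ ks)

instance
  all-[] : All NonZero []
  all-[] = []

  all-∷ : ∀ {k ks} → {{NonZero k}} → {{All NonZero ks}} → All NonZero (k ∷ ks)
  all-∷ {{k≢0}} {{h}} = k≢0 ∷ h

  +-nonTrivial : ∀ {m n} → .{{NonTrivial m}} → NonTrivial (m ℕ.+ n)
  +-nonTrivial {m} {n} = ℕ.n>1⇒nonTrivial
    (ℕP.≤-trans (ℕ.nonTrivial⇒n>1 m) (ℕP.m≤m+n m n))

  +-nonZero : ∀ {m n} → .{{NonZero m}} → NonZero (m ℕ.+ n)
  +-nonZero {m} {n} = ℕ.>-nonZero (ℕP.≤-trans (ℕ.>-nonZero⁻¹ m) (ℕP.m≤m+n m n))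

------------------------------------------------------------------------
-- Convergence of the truncated sums
--
-- With P n = ∏_{1 ≤ j ≤ n} (1 + 1/(3j)), a truncated sum of depth r is at most
-- 6^r · P n.  When k₁ ≥ 2 the tail of the sum telescopes against
-- R n = P n / (n + 1), and R n ² ≤ 1/(n + 1).

u : ℕ → ℚ
u n = + 1 / suc n

P : ℕ → ℚ
P zero    = 1ℚ
P (suc n) = P n * (1ℚ + (+ 1 / 3) * u n)

R : ℕ → ℚ
R n = P n * u n

2ℚ 6ℚ : ℚ
2ℚ = + 2 / 1
6ℚ = + 6 / 1

6^ : ℕ → ℚ
6^ zero    = 1ℚ
6^ (suc r) = 6ℚ * 6^ r

/-nonNeg : ∀ a b .{{_ : NonZero b}} → 0ℚ ≤ + a / b
/-nonNeg a b = nonNegative⁻¹ (+ a / b) {{normalize-nonNeg a b}}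

n/n≡1 : ∀ n .{{_ : NonZero n}} → + n / n ≡ 1ℚ
n/n≡1 n = ≤-antisym
  (/-mono-≤ n n 1 1 (ℕP.≤-reflexive (ℕP.*-comm n 1)))
  (/-mono-≤ 1 1 n n (ℕP.≤-reflexive (ℕP.*-comm 1 n)))

0<u : ∀ n → 0ℚ < u n
0<u n = positive⁻¹ (u n) {{normalize-pos 1 (suc n)}}

0≤u : ∀ n → 0ℚ ≤ u n
0≤u n = <⇒≤ (0<u n)

u≤1 : ∀ n → u n ≤ 1ℚ
u≤1 n = /-mono-≤ 1 (suc n) 1 1 (ℕP.*-monoʳ-≤ 1 (ℕ.s≤s ℕ.z≤n))

n*u : ∀ n → (+ suc n / 1) * u n ≡ 1ℚ
n*u n = trans (/-*-/ (suc n) 1 1 (suc n))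
  (trans (cong (λ z → + z / (1 ℕ.* suc n)) (ℕP.*-comm (suc n) 1)) (n/n≡1 (1 ℕ.* suc n)))

telescope-expand : ∀ x a b → a * ((1ℚ + x) * b) ≡ (x * a) * b + a * b
telescope-expand = solve 3
  (λ x a b → a :* ((con 1ℚ :+ x) :* b) := (x :* a) :* b :+ a :* b) refl

telescope : ∀ x y a b → x * a ≡ 1ℚ → y * b ≡ 1ℚ → 1ℚ + x ≡ y → a ≡ b + a * b
telescope x y a b xa yb refl =
  trans (sym (*-identityʳ a)) (trans (cong (a *_) (sym yb))
  (trans (telescope-expand x a b)
  (trans (cong (λ z → z * b + a * b) xa) (cong (_+ a * b) (*-identityˡ b)))))

u-step : ∀ n → u n ≡ u (suc n) + u n * u (suc n)
u-step n = telescope (+ suc n / 1) (+ suc (suc n) / 1) (u n) (u (suc n))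
  (n*u n) (n*u (suc n)) (/1-+-/1 1 (suc n))

u≤2u : ∀ n → u n ≤ u (suc n) + u (suc n)
u≤2u n = subst (_≤ u (suc n) + u (suc n)) (sym (u-step n)) (+-monoʳ-≤ (u (suc n))
  (subst (u n * u (suc n) ≤_) (*-identityˡ (u (suc n)))
    (*-monoʳ {u (suc n)} {u n} {1ℚ} (0≤u (suc n)) (u≤1 n))))

archimedean : ∀ δ → 0ℚ < δ → ∃ λ N → ∀ n → N ℕ.≤ n → u n < δ
archimedean δ@(mkℚ ℤ.+0 b _) 0<δ with () ← positive 0<δ
archimedean δ@(mkℚ ℤ.-[1+ a ] b _) 0<δ with () ← positive 0<δ
archimedean δ@(mkℚ ℤ.+[1+ a ] b _) 0<δ = suc b , λ n b<n →
  toℚᵘ-cancel-< (ℚᵘP.<-respˡ-≃ (ℚᵘP.≃-sym (toℚᵘ-/ (+ 1) (suc n)))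
    (ℚᵘ.*<* (subst₂ ℤ._<_ (ℤP.pos-* 1 (suc b)) (ℤP.pos-* (suc a) (suc n))
      (ℤ.+<+ (ℕP.<-≤-trans
        (subst (ℕ._< suc n) (sym (ℕP.*-identityˡ (suc b))) (ℕ.s≤s b<n))
        (ℕP.m≤n*m (suc n) (suc a)))))))

1≤P : ∀ n → 1ℚ ≤ P n
1≤P zero    = ≤-refl
1≤P (suc n) = ≤-trans (1≤P n)
  (subst (_≤ P (suc n)) (*-identityʳ (P n))
    (*-monoˡ {P n} {1ℚ} {1ℚ + (+ 1 / 3) * u n} (≤-trans 0≤1 (1≤P n))
      (p≤p+q {1ℚ} (0≤* {+ 1 / 3} {u n} (/-nonNeg 1 3) (0≤u n)))))

0≤P : ∀ n → 0ℚ ≤ P n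
0≤P n = ≤-trans 0≤1 (1≤P n)

0≤R : ∀ n → 0ℚ ≤ R n
0≤R n = 0≤* {P n} {u n} (0≤P n) (0≤u n)

P²u-expand : ∀ p a v →
  (p * p) * (v + (+ 2 / 3) * (a * v) + (+ 1 / 9) * (a * (a * v))) ≡
  (p * (1ℚ + (+ 1 / 3) * a)) * (p * (1ℚ + (+ 1 / 3) * a)) * v
P²u-expand = solve 3 (λ p a v →
  (p :* p) :* (v :+ con (+ 2 / 3) :* (a :* v) :+ con (+ 1 / 9) :* (a :* (a :* v))) :=
  (p :* (con 1ℚ :+ con (+ 1 / 3) :* a)) :* (p :* (con 1ℚ :+ con (+ 1 / 3) :* a)) :* v) refl

P²u-collect : ∀ v w →
  v + (+ 2 / 3) * w + (+ 1 / 9) * (1ℚ * w) + (+ 2 / 9) * w ≡ v + w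
P²u-collect = solve 2 (λ v w →
  v :+ con (+ 2 / 3) :* w :+ con (+ 1 / 9) :* (con 1ℚ :* w) :+ con (+ 2 / 9) :* w := v :+ w) refl

P²u-factor : ∀ a v → 0ℚ ≤ a → 0ℚ ≤ v → a ≤ 1ℚ → a ≡ v + a * v →
  v + (+ 2 / 3) * (a * v) + (+ 1 / 9) * (a * (a * v)) ≤ a
P²u-factor a v 0≤a 0≤v a≤1 eq = ≤-trans
  (+-monoʳ-≤ (v + (+ 2 / 3) * (a * v))
    (*-monoˡ {+ 1 / 9} {a * (a * v)} {1ℚ * (a * v)} (/-nonNeg 1 9)
      (*-monoʳ {a * v} {a} {1ℚ} 0≤av a≤1)))
  (≤-trans (p≤p+q {q = (+ 2 / 9) * (a * v)} (0≤* {+ 2 / 9} {a * v} (/-nonNeg 2 9) 0≤av))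
    (≤-reflexive (trans (P²u-collect v (a * v)) (sym eq))))
  where
  0≤av : 0ℚ ≤ a * v
  0≤av = 0≤* {a} {v} 0≤a 0≤v

P²u≤1 : ∀ n → P n * P n * u n ≤ 1ℚ
P²u≤1 zero    = ≤-refl
P²u≤1 (suc n) = ≤-trans
  (subst (_≤ P n * P n * u n) (P²u-expand (P n) (u n) (u (suc n)))
    (*-monoˡ {P n * P n} (0≤* {P n} {P n} (0≤P n) (0≤P n))
      (P²u-factor (u n) (u (suc n)) (0≤u n) (0≤u (suc n)) (u≤1 n) (u-step n))))
  (P²u≤1 n)

square-* : ∀ p q → (p * p) * (q * q) ≡ (p * q) * (p * q)
square-* = solve 2 (λ p q → (p :* p) :* (q :* q) := (p :* q) :* (p :* q)) refl

R²≤u : ∀ n → R n * R n ≤ u n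
R²≤u n = subst₂ _≤_
  (trans (*-assoc (P n * P n) (u n) (u n)) (square-* (P n) (u n)))
  (*-identityˡ (u n))
  (*-monoʳ {u n} {P n * P n * u n} {1ℚ} (0≤u n) (P²u≤1 n))

0<6^ : ∀ r → 0ℚ < 6^ r
0<6^ zero    = positive⁻¹ 1ℚ
0<6^ (suc r) = 0<* {6ℚ} {6^ r} (positive⁻¹ 6ℚ) (0<6^ r)

0≤6^ : ∀ r → 0ℚ ≤ 6^ r
0≤6^ r = <⇒≤ (0<6^ r)

R-vanishes : ∀ r ε → 0ℚ < ε → ∃ λ N → ∀ n → N ℕ.≤ n → 6^ r * R n < ε
R-vanishes r ε 0<ε =
  let
    0<d² = 0<* {6^ r} {6^ r} (0<6^ r) (0<6^ r)
    δ , 0<δ , eq = divide (6^ r * 6^ r) (ε * ε) 0<d² (0<* {ε} {ε} 0<ε 0<ε)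
    N , h = archimedean δ 0<δ
  in N , λ n N≤n → square-cancel-< {6^ r * R n} {ε} (<⇒≤ 0<ε)
    (subst₂ _<_ (square-* (6^ r) (R n)) eq
      (≤-<-trans (*-monoˡ {6^ r * 6^ r} {R n * R n} {u n} (<⇒≤ 0<d²) (R²≤u n))
        (*-monoʳ-<-pos (6^ r * 6^ r) {{positive 0<d²}} (h n N≤n))))

increasing : ∀ (f : ℕ → ℚ) → (∀ n → f n ≤ f (suc n)) → ∀ {m n} → m ℕ.≤ n → f m ≤ f n
increasing f h {m} m≤n = go (ℕP.≤⇒≤′ m≤n)
  where
  go : ∀ {n} → m ℕ.≤′ n → f m ≤ f n
  go ℕ.≤′-refl     = ≤-refl
  go (ℕ.≤′-step p) = ≤-trans (go p) (h _)

decreasing : ∀ (f : ℕ → ℚ) → (∀ n → f (suc n) ≤ f n) → ∀ {m n} → m ℕ.≤ n → f n ≤ f m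
decreasing f h {m} m≤n = go (ℕP.≤⇒≤′ m≤n)
  where
  go : ∀ {n} → m ℕ.≤′ n → f n ≤ f m
  go ℕ.≤′-refl     = ≤-refl
  go (ℕ.≤′-step p) = ≤-trans (h _) (go p)

bound-expand : ∀ d p a →
  6ℚ * d * p + 2ℚ * a * (d * p) ≡ 6ℚ * d * (p * (1ℚ + (+ 1 / 3) * a))
bound-expand = solve 3 (λ d p a →
  con 6ℚ :* d :* p :+ con 2ℚ :* a :* (d :* p) :=
  con 6ℚ :* d :* (p :* (con 1ℚ :+ con (+ 1 / 3) :* a))) refl

tail-expand : ∀ s d p a v →
  (s + 2ℚ * (a * (v + v)) * (d * p)) + 6ℚ * d * (p * (1ℚ + (+ 1 / 3) * a) * v) ≡
  s + 6ℚ * d * (p * (v + a * v))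
tail-expand = solve 5 (λ s d p a v →
  (s :+ con 2ℚ :* (a :* (v :+ v)) :* (d :* p)) :+
    con 6ℚ :* d :* (p :* (con 1ℚ :+ con (+ 1 / 3) :* a) :* v) :=
  s :+ con 6ℚ :* d :* (p :* (v :+ a :* v))) refl

add-subtract : ∀ s x → (s + x) - s ≡ x
add-subtract = solve 2 (λ s x → (s :+ x) :- s := x) refl

0≤term : ∀ w r k n → 0ℚ ≤ term w r k n
0≤term w r k n = /-nonNeg (w r (suc n)) (suc n ℕ.^ k) {{ℕP.m^n≢0 (suc n) k}}

0≤truncated : ∀ w ks N → 0ℚ ≤ truncated w ks N
0≤truncated w []       N       = 0≤1
0≤truncated w (k ∷ ks) zero    = ≤-refl
0≤truncated w (k ∷ ks) (suc N) =
  0≤+ {truncated w (k ∷ ks) N} (0≤truncated w (k ∷ ks) N)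
    (0≤* {term w (suc (length ks)) k N} {truncated w ks N}
      (0≤term w (suc (length ks)) k N) (0≤truncated w ks N))

module _ (w : Weight) (w≤2 : ∀ r n → w r n ℕ.≤ 2) where

  term≤2u : ∀ r k n → .{{_ : NonZero k}} → term w r k n ≤ 2ℚ * u n
  term≤2u r k@(suc k-1) n = subst (term w r k n ≤_) (sym (/-*-/ 2 1 1 (suc n)))
    (/-mono-≤ (w r (suc n)) (suc n ℕ.^ k) 2 (1 ℕ.* suc n)
      {{ℕP.m^n≢0 (suc n) k}}
      (ℕP.*-mono-≤ (w≤2 r (suc n)) (ℕP.≤-trans
        (ℕP.≤-reflexive (ℕP.*-identityˡ (suc n)))
        (ℕP.m≤m*n (suc n) (suc n ℕ.^ k-1) {{ℕP.m^n≢0 (suc n) k-1}}))))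

  term≤2u² : ∀ r k n → .{{_ : NonTrivial k}} → term w r k n ≤ 2ℚ * (u n * u n)
  term≤2u² r k@(suc (suc k-2)) n = subst (term w r k n ≤_)
    (sym (trans (cong (2ℚ *_) (/-*-/ 1 (suc n) 1 (suc n))) (/-*-/ 2 1 1 (suc n ℕ.* suc n))))
    (/-mono-≤ (w r (suc n)) (suc n ℕ.^ k) 2 (1 ℕ.* (suc n ℕ.* suc n))
      {{ℕP.m^n≢0 (suc n) k}}
      (ℕP.*-mono-≤ (w≤2 r (suc n)) (ℕP.≤-trans
        (ℕP.≤-reflexive (ℕP.*-identityˡ (suc n ℕ.* suc n)))
        (ℕP.*-monoʳ-≤ (suc n)
          (ℕP.m≤m*n (suc n) (suc n ℕ.^ k-2) {{ℕP.m^n≢0 (suc n) k-2}})))))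

  truncated≤ : ∀ {ks} → All NonZero ks → ∀ N → truncated w ks N ≤ 6^ (length ks) * P N
  truncated≤ {[]} [] N = subst (1ℚ ≤_) (sym (*-identityˡ (P N))) (1≤P N)
  truncated≤ {k ∷ ks} (k≢0 ∷ h) zero =
    0≤* {6^ (suc (length ks))} {1ℚ} (0≤6^ (suc (length ks))) 0≤1
  truncated≤ {k ∷ ks} (k≢0 ∷ h) (suc N) = ≤-trans
    (+-mono-≤ (truncated≤ (k≢0 ∷ h) N)
      (≤-trans
        (*-monoˡ {term w (suc (length ks)) k N} (0≤term w (suc (length ks)) k N)
          (truncated≤ h N))
        (*-monoʳ {6^ (length ks) * P N} (0≤* {6^ (length ks)} {P N} (0≤6^ (length ks)) (0≤P N))
          (term≤2u (suc (length ks)) k N {{k≢0}}))))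
    (≤-reflexive (bound-expand (6^ (length ks)) (P N) (u N)))

  module _ (k : ℕ) (ks : List ℕ) {{_ : NonTrivial k}} (h : All NonZero ks) where

    private
      r = length ks

      S : ℕ → ℚ
      S = truncated w (k ∷ ks)

    increment≤ : ∀ N → term w (suc r) k N * truncated w ks N ≤
                       2ℚ * (u N * (u (suc N) + u (suc N))) * (6^ r * P N)
    increment≤ N = ≤-trans
      (*-monoˡ {term w (suc r) k N} (0≤term w (suc r) k N) (truncated≤ h N))
      (*-monoʳ {6^ r * P N} (0≤* {6^ r} {P N} (0≤6^ r) (0≤P N))
        (≤-trans (term≤2u² (suc r) k N)
          (*-monoˡ {2ℚ} (/-nonNeg 2 1) (*-monoˡ {u N} (0≤u N) (u≤2u N)))))

    step≤ : ∀ N → S (suc N) + 6^ (suc r) * R (suc N) ≤ S N + 6^ (suc r) * R N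
    step≤ N = ≤-trans
      (+-monoˡ-≤ (6^ (suc r) * R (suc N)) (+-monoʳ-≤ (S N) (increment≤ N)))
      (≤-reflexive (trans (tail-expand (S N) (6^ r) (P N) (u N) (u (suc N)))
        (cong (λ z → S N + 6^ (suc r) * (P N * z)) (sym (u-step N)))))

    step≥ : ∀ N → S N ≤ S (suc N)
    step≥ N = p≤p+q {S N} (0≤* {term w (suc r) k N} {truncated w ks N}
      (0≤term w (suc r) k N) (0≤truncated w ks N))

    difference≤ : ∀ m n → m ℕ.≤ n → ∣ S n - S m ∣ ≤ 6^ (suc r) * R m
    difference≤ m n m≤n = subst (_≤ 6^ (suc r) * R m)
      (sym (0≤p⇒∣p∣≡p {S n - S m} (0≤q-p {S m} {S n} (increasing S step≥ m≤n))))
      (subst (S n - S m ≤_)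
        (add-subtract (S m) (6^ (suc r) * R m))
        (+-monoˡ-≤ (- S m) {S n} {S m + 6^ (suc r) * R m} (≤-trans
          (p≤p+q {S n} {6^ (suc r) * R n} (0≤* {6^ (suc r)} {R n} (0≤6^ (suc r)) (0≤R n)))
          (decreasing (λ j → S j + 6^ (suc r) * R j) step≤ m≤n))))

    truncated-cauchy : IsCauchy S
    truncated-cauchy =
      tail-cauchy S (λ m → 6^ (suc r) * R m) difference≤ (R-vanishes (suc r))

------------------------------------------------------------------------
-- Multiple zeta values and multiple T-values

ζ-weight : Weight
ζ-weight r n = 1

-- n_j contributes only if n_j ≡ r + 1 - j (mod 2); a factor 2 for each of the r
-- variables gives the numerator 2^r.

T-weight : Weight
T-weight r n = if does (n % 2 ℕP.≟ r % 2) then 2 else 0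

T-weight≤2 : ∀ r n → T-weight r n ℕ.≤ 2
T-weight≤2 r n with does (n % 2 ℕP.≟ r % 2)
... | true  = ℕP.≤-refl
... | false = ℕ.z≤n

multipleSum : (w : Weight) → (∀ r n → w r n ℕ.≤ 2) → ∀ ks → {{Admissible ks}} → ℝ
multipleSum w w≤2 (k ∷ ks) {{admissible {{k>1}} {{h}}}} =
  mkℝ (truncated w (k ∷ ks)) (truncated-cauchy w w≤2 k ks {{k>1}} h)

ζ : ∀ ks → {{Admissible ks}} → ℝ
ζ = multipleSum ζ-weight λ _ _ → ℕ.s≤s ℕ.z≤n

T : ∀ ks → {{Admissible ks}} → ℝ
T = multipleSum T-weight T-weight≤2

module Submission where

-- For X = Y + Z the residues of t⁻ᵐ (X - t)⁻ᵖ (Y - t)^(-q) at t = 0, X and Y add up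
-- to 0.  Written out, this is the theorem with the sums over n₁ > n₂ replaced by
-- the single terms at (X , Y), at (X , Z) and at (Y , Z).  Summing it over Y + Z ≤ N
-- turns the left-hand side into the truncated sums, and the right-hand side into
-- sums over a triangle, which lies between the squares of side ⌊N/2⌋ and N, so that
-- its sum has the same limit as the truncated product of single sums.  The T-values
-- only add weights, and if Z = X - Y, then X is even and Y is odd exactly when Y and Z
-- are odd.

module MultipleSums where

  open import Defs
  open import Algebra.Bundles using (CommutativeRing)
  open import Data.Integer.Base as ℤ using (ℤ; +_; -1ℤ)
  open import Data.List.Base using ([]; _∷_)
  open import Data.Nat.Base as ℕ
    using (ℕ; zero; suc; NonZero; NonTrivial; nonTrivial⇒nonZero)
  open import Data.Nat.Combinatorics
    using (_C_; nCk+nC[k+1]≡[n+1]C[k+1]; nCk≡nC[n∸k]; k>n⇒nCk≡0)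
  import Data.Nat.Properties as ℕP
  open import Data.Product.Base using (∃; _,_)
  open import Data.Rational.Base
    using (ℚ; 0ℚ; 1ℚ; _+_; _*_; _-_; -_; _/_; _≤_; _<_; ∣_∣; positive)
  open import Data.Rational.Properties
  open import Data.Rational.Solver using (module +-*-Solver)
  import Data.Rational.Unnormalised.Properties as ℚᵘP
  open import Relation.Binary.PropositionalEquality
    using (_≡_; refl; sym; trans; cong; cong₂; subst; subst₂; module ≡-Reasoning)
  open import Algebra.Properties.Semiring.Exp
    (CommutativeRing.semiring +-*-commutativeRing) using (_^_)
  open +-*-Solver
  open ≡-Reasoning

  -- Finite sums over i + j = n

  ∑ : ℕ → (ℕ → ℕ → ℚ) → ℚ
  ∑ zero    f = f 0 0
  ∑ (suc n) f = f 0 (suc n) + ∑ n (λ i j → f (suc i) j)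

  ∑-cong : ∀ n {f g} → (∀ i j → i ℕ.+ j ≡ n → f i j ≡ g i j) → ∑ n f ≡ ∑ n g
  ∑-cong zero    f≡g = f≡g 0 0 refl
  ∑-cong (suc n) f≡g = cong₂ _+_ (f≡g 0 (suc n) refl)
    (∑-cong n λ i j eq → f≡g (suc i) j (cong suc eq))

  ∑-zero : ∀ n {f} → (∀ i j → f i j ≡ 0ℚ) → ∑ n f ≡ 0ℚ
  ∑-zero zero    f≡0 = f≡0 0 0
  ∑-zero (suc n) f≡0 = cong₂ _+_ (f≡0 0 (suc n)) (∑-zero n λ i j → f≡0 (suc i) j)

  ∑-nonNeg : ∀ n {f} → (∀ i j → 0ℚ ≤ f i j) → 0ℚ ≤ ∑ n f
  ∑-nonNeg zero        0≤f = 0≤f 0 0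
  ∑-nonNeg (suc n) {f} 0≤f = 0≤+ {f 0 (suc n)} (0≤f 0 (suc n)) (∑-nonNeg n λ i j → 0≤f (suc i) j)

  ∑-mono-≤ : ∀ n {f g} → (∀ i j → i ℕ.+ j ≡ n → f i j ≤ g i j) → ∑ n f ≤ ∑ n g
  ∑-mono-≤ zero    f≤g = f≤g 0 0 refl
  ∑-mono-≤ (suc n) f≤g = +-mono-≤ (f≤g 0 (suc n) refl)
    (∑-mono-≤ n λ i j eq → f≤g (suc i) j (cong suc eq))

  +-interchange : ∀ p q r s → (p + q) + (r + s) ≡ (p + r) + (q + s)
  +-interchange = solve 4 (λ p q r s → (p :+ q) :+ (r :+ s) := (p :+ r) :+ (q :+ s)) refl

  ∑-+ : ∀ n f g → ∑ n (λ i j → f i j + g i j) ≡ ∑ n f + ∑ n g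
  ∑-+ zero    f g = refl
  ∑-+ (suc n) f g = trans
    (cong (λ s → (f 0 (suc n) + g 0 (suc n)) + s)
      (∑-+ n (λ i j → f (suc i) j) (λ i j → g (suc i) j)))
    (+-interchange (f 0 (suc n)) (g 0 (suc n)) _ _)

  ∑-- : ∀ n f g → ∑ n (λ i j → f i j - g i j) ≡ ∑ n f - ∑ n g
  ∑-- zero    f g = refl
  ∑-- (suc n) f g = trans
    (cong (λ s → (f 0 (suc n) - g 0 (suc n)) + s)
      (∑-- n (λ i j → f (suc i) j) (λ i j → g (suc i) j)))
    (+-rearrange (f 0 (suc n)) (g 0 (suc n))
      (∑ n (λ i j → f (suc i) j)) (∑ n (λ i j → g (suc i) j)))

  ∑-* : ∀ n c f → ∑ n (λ i j → c * f i j) ≡ c * ∑ n f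
  ∑-* zero    c f = refl
  ∑-* (suc n) c f = trans
    (cong (λ s → c * f 0 (suc n) + s) (∑-* n c (λ i j → f (suc i) j)))
    (sym (*-distribˡ-+ c (f 0 (suc n)) _))

  ∑-init : ∀ n f → ∑ (suc n) f ≡ ∑ n (λ i j → f i (suc j)) + f (suc n) 0
  ∑-init zero    f = refl
  ∑-init (suc n) f = trans
    (cong (λ s → f 0 (suc (suc n)) + s) (∑-init n (λ i j → f (suc i) j)))
    (sym (+-assoc (f 0 (suc (suc n))) _ _))

  ∑-comm : ∀ n f → ∑ n f ≡ ∑ n (λ i j → f j i)
  ∑-comm zero    f = refl
  ∑-comm (suc n) f = trans (+-comm (f 0 (suc n)) _) (trans
    (cong (_+ f 0 (suc n)) (∑-comm n (λ i j → f (suc i) j)))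
    (sym (∑-init n (λ i j → f j i))))

  -- Power series as coefficient sequences, with the Cauchy product

  infixl 7 _⋆_

  _⋆_ : (ℕ → ℚ) → (ℕ → ℚ) → ℕ → ℚ
  (f ⋆ g) n = ∑ n λ i j → f i * g j

  ⋆-comm : ∀ f g n → (f ⋆ g) n ≡ (g ⋆ f) n
  ⋆-comm f g n = trans (∑-comm n (λ i j → f i * g j))
    (∑-cong n λ i j _ → *-comm (f j) (g i))

  ⋆-identityˡ : ∀ {f} g → f 0 ≡ 1ℚ → (∀ n → f (suc n) ≡ 0ℚ) → ∀ n → (f ⋆ g) n ≡ g n
  ⋆-identityˡ g f₀ f₊ zero    = trans (cong (_* g 0) f₀) (*-identityˡ (g 0))
  ⋆-identityˡ g f₀ f₊ (suc n) = trans
    (cong₂ _+_ (trans (cong (_* g (suc n)) f₀) (*-identityˡ (g (suc n))))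
      (∑-zero n λ i j → trans (cong (_* g j) (f₊ i)) (*-zeroˡ (g j))))
    (+-identityʳ (g (suc n)))

  -- Multiplication by t.
  shift : (ℕ → ℚ) → ℕ → ℚ
  shift f zero    = 0ℚ
  shift f (suc n) = f n

  -- Read with f and h as power series in t: (X - σt) f = h.
  Divides : ℚ → ℚ → (ℕ → ℚ) → (ℕ → ℚ) → Set
  Divides X σ f h = ∀ n → X * f n ≡ σ * shift f n + h n

  -- The equation (X - σt) f = h is multiplied by the series g. On coefficients, the term with i = 0
  -- is split off and the hypothesis is applied to each remaining `f (suc i)`.
  Divides-⋆ : ∀ X σ f h → Divides X σ f h → ∀ g → Divides X σ (f ⋆ g) (h ⋆ g)
  Divides-⋆ X σ f h d g zero = begin
    X * (f 0 * g 0)               ≡⟨ *-assoc X (f 0) (g 0) ⟨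
    X * f 0 * g 0                 ≡⟨ cong (_* g 0) (d 0) ⟩
    (σ * 0ℚ + h 0) * g 0          ≡⟨ drop σ (h 0) (g 0) ⟩
    σ * 0ℚ + h 0 * g 0            ∎
    where
    drop : ∀ s a b → (s * 0ℚ + a) * b ≡ s * 0ℚ + a * b
    drop = solve 3 (λ s a b →
      (s :* con 0ℚ :+ a) :* b := s :* con 0ℚ :+ a :* b) refl
  Divides-⋆ X σ f h d g (suc n) = begin
    X * (f 0 * g (suc n) + ∑ n (λ i j → f (suc i) * g j))
      ≡⟨ expand X (f 0) (g (suc n)) (∑ n (λ i j → f (suc i) * g j)) ⟩
    X * f 0 * g (suc n) + X * ∑ n (λ i j → f (suc i) * g j)
      ≡⟨ cong₂ _+_ (cong (_* g (suc n)) (d 0)) (trans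
           (sym (∑-* n X (λ i j → f (suc i) * g j)))
           (trans (∑-cong n λ i j _ → step i (g j))
           (trans (∑-+ n (λ i j → σ * (f i * g j)) (λ i j → h (suc i) * g j))
             (cong (_+ ∑ n (λ i j → h (suc i) * g j)) (∑-* n σ (λ i j → f i * g j)))))) ⟩
    (σ * 0ℚ + h 0) * g (suc n) + (σ * (f ⋆ g) n + ∑ n (λ i j → h (suc i) * g j))
      ≡⟨ collect σ (h 0) (g (suc n)) ((f ⋆ g) n) (∑ n (λ i j → h (suc i) * g j)) ⟩
    σ * (f ⋆ g) n + (h 0 * g (suc n) + ∑ n (λ i j → h (suc i) * g j)) ∎
    where
    expand : ∀ x a b c → x * (a * b + c) ≡ x * a * b + x * c
    expand = solve 4 (λ x a b c → x :* (a :* b :+ c) := x :* a :* b :+ x :* c) refl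
    collect : ∀ s a b c d → (s * 0ℚ + a) * b + (s * c + d) ≡ s * c + (a * b + d)
    collect = solve 5 (λ s a b c d →
      (s :* con 0ℚ :+ a) :* b :+ (s :* c :+ d) := s :* c :+ (a :* b :+ d)) refl
    distribute : ∀ s a b c → (s * a + b) * c ≡ s * (a * c) + b * c
    distribute = solve 4 (λ s a b c → (s :* a :+ b) :* c := s :* (a :* c) :+ b :* c) refl
    step : ∀ i b → X * (f (suc i) * b) ≡ σ * (f i * b) + h (suc i) * b
    step i b = trans (sym (*-assoc X (f (suc i)) b))
      (trans (cong (_* b) (d (suc i))) (distribute σ (f i) (h (suc i)) b))

  Divides-⋆ʳ : ∀ X σ f h → Divides X σ f h → ∀ g → Divides X σ (g ⋆ f) (g ⋆ h)
  Divides-⋆ʳ X σ f h d g n = begin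
    X * (g ⋆ f) n                         ≡⟨ cong (X *_) (⋆-comm g f n) ⟩
    X * (f ⋆ g) n                         ≡⟨ Divides-⋆ X σ f h d g n ⟩
    σ * shift (f ⋆ g) n + (h ⋆ g) n       ≡⟨ cong₂ (λ a b → σ * a + b) (shift-comm n) (⋆-comm h g n) ⟩
    σ * shift (g ⋆ f) n + (g ⋆ h) n       ∎
    where
    shift-comm : ∀ n → shift (f ⋆ g) n ≡ shift (g ⋆ f) n
    shift-comm zero    = refl
    shift-comm (suc n) = ⋆-comm f g n

  -- Signs, binomial coefficients and the expansion of a pole

  /1-*-/1 : ∀ i j → (i / 1) * (j / 1) ≡ (i ℤ.* j) / 1
  /1-*-/1 i j = toℚᵘ-injective
    (ℚᵘP.≃-trans (toℚᵘ-homo-* (i / 1) (j / 1))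
    (ℚᵘP.≃-trans (ℚᵘP.*-cong (toℚᵘ-/ i 1) (toℚᵘ-/ j 1))
    (ℚᵘP.≃-sym (toℚᵘ-/ (i ℤ.* j) 1))))

  sgn : ℕ → ℚ
  sgn n = (-1ℤ ℤ.^ n) / 1

  sgn-suc : ∀ n → sgn (suc n) ≡ - sgn n
  sgn-suc n = trans (sym (/1-*-/1 -1ℤ (-1ℤ ℤ.^ n))) (-1* (sgn n))
    where
    -1* : ∀ p → (-1ℤ / 1) * p ≡ - p
    -1* = solve 1 (λ p → con (-1ℤ / 1) :* p := :- p) refl

  -- coeff p i is the coefficient of tⁱ in (1 - t)⁻ᵖ; for p = 0 the truncated
  -- subtraction yields the coefficients of 1, as it should.

  coeff : ℕ → ℕ → ℕ
  coeff p i = (p ℕ.+ i ℕ.∸ 1) C i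

  -- Pascal's rule; for the series it says that (1 - t) (1 - t)⁻ᵖ⁻¹ = (1 - t)⁻ᵖ.
  coeff-suc : ∀ p i → coeff (suc p) (suc i) ≡ coeff (suc p) i ℕ.+ coeff p (suc i)
  -- The rewriting exposes a successor, on which the truncated subtraction of 1 computes.
  coeff-suc p i rewrite ℕP.+-suc p i = sym (nCk+nC[k+1]≡[n+1]C[k+1] (p ℕ.+ i) i)

  coeff-comm : ∀ p q → coeff (suc p) q ≡ coeff (suc q) p
  coeff-comm p q = trans (nCk≡nC[n∸k] (ℕP.m≤n+m q p))
    (cong₂ _C_ (ℕP.+-comm p q) (ℕP.m+n∸n≡m p q))

  -- The power series (x⁻¹ - t)⁻ᵖ.

  pole : ℕ → ℚ → ℕ → ℚ
  pole p x i = (+ coeff p i / 1) * x ^ (p ℕ.+ i)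

  -- This closes the base cases of the residue identity, where a convolution collapses to one
  -- coefficient and the order of the pole trades places with the index.
  pole-comm : ∀ p q x → pole (suc p) x q ≡ pole (suc q) x p
  pole-comm p q x = cong₂ (λ k e → (+ k / 1) * x ^ e) (coeff-comm p q) (cong suc (ℕP.+-comm p q))

  -- A factor X - t lowers the order of the pole by one: X cancels one factor x, and Pascal's rule
  -- splits the coefficient.
  pole-divides : ∀ X x → X * x ≡ 1ℚ → ∀ p → Divides X 1ℚ (pole (suc p) x) (pole p x)
  pole-divides X x Xx p zero = begin
    X * (1ℚ * (x * e))  ≡⟨ expand X x e ⟩
    (X * x) * e         ≡⟨ cong (_* e) Xx ⟩
    1ℚ * e              ≡⟨ +-identityˡ (1ℚ * e) ⟨
    1ℚ * 0ℚ + 1ℚ * e ∎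
    where
    e = x ^ (p ℕ.+ 0)
    expand : ∀ X x e → X * (1ℚ * (x * e)) ≡ (X * x) * e
    expand = solve 3 (λ X x e → X :* (con 1ℚ :* (x :* e)) := (X :* x) :* e) refl
  pole-divides X x Xx p (suc n) = begin
    X * ((+ coeff (suc p) (suc n) / 1) * (x * e))
      ≡⟨ expand X (+ coeff (suc p) (suc n) / 1) x e ⟩
    (X * x) * ((+ coeff (suc p) (suc n) / 1) * e)
      ≡⟨ trans (cong (_* ((+ coeff (suc p) (suc n) / 1) * e)) Xx) (*-identityˡ _) ⟩
    (+ coeff (suc p) (suc n) / 1) * e
      ≡⟨ cong (λ k → (+ k / 1) * e) (coeff-suc p n) ⟩
    (+ (coeff (suc p) n ℕ.+ coeff p (suc n)) / 1) * e
      ≡⟨ cong (_* e) (/1-+-/1 (coeff (suc p) n) (coeff p (suc n))) ⟨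
    ((+ coeff (suc p) n / 1) + (+ coeff p (suc n) / 1)) * e
      ≡⟨ collect (+ coeff (suc p) n / 1) (+ coeff p (suc n) / 1) e ⟩
    1ℚ * ((+ coeff (suc p) n / 1) * e) + (+ coeff p (suc n) / 1) * e
      ≡⟨ cong (λ k → 1ℚ * ((+ coeff (suc p) n / 1) * x ^ k) + (+ coeff p (suc n) / 1) * e) (ℕP.+-suc p n) ⟩
    1ℚ * pole (suc p) x n + pole p x (suc n) ∎
    where
    e = x ^ (p ℕ.+ suc n)
    expand : ∀ X k x e → X * (k * (x * e)) ≡ (X * x) * (k * e)
    expand = solve 4 (λ X k x e → X :* (k :* (x :* e)) := (X :* x) :* (k :* e)) refl
    collect : ∀ k l e → (k + l) * e ≡ 1ℚ * (k * e) + l * e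
    collect = solve 3 (λ k l e → (k :+ l) :* e := con 1ℚ :* (k :* e) :+ l :* e) refl

  -- The power series (z⁻¹ + t)⁻ᵖ.

  pole⁻ : ℕ → ℚ → ℕ → ℚ
  pole⁻ p z j = sgn j * pole p z j

  -- Substituting -t for t in `pole-divides` changes σ from 1 to -1.
  pole⁻-divides : ∀ Z z → Z * z ≡ 1ℚ → ∀ p → Divides Z (- 1ℚ) (pole⁻ (suc p) z) (pole⁻ p z)
  pole⁻-divides Z z Zz p n = begin
    Z * (sgn n * pole (suc p) z n)            ≡⟨ swap Z (sgn n) (pole (suc p) z n) ⟩
    sgn n * (Z * pole (suc p) z n)            ≡⟨ cong (sgn n *_) (pole-divides Z z Zz p n) ⟩
    sgn n * (1ℚ * shift (pole (suc p) z) n + pole p z n)  ≡⟨ *-distribˡ-+ (sgn n) _ _ ⟩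
    sgn n * (1ℚ * shift (pole (suc p) z) n) + pole⁻ p z n  ≡⟨ cong (_+ pole⁻ p z n) (sign n) ⟩
    - 1ℚ * shift (pole⁻ (suc p) z) n + pole⁻ p z n ∎
    where
    swap : ∀ x y z → x * (y * z) ≡ y * (x * z)
    swap = solve 3 (λ x y z → x :* (y :* z) := y :* (x :* z)) refl
    neg : ∀ x y → - x * (1ℚ * y) ≡ - 1ℚ * (x * y)
    neg = solve 2 (λ x y → :- x :* (con 1ℚ :* y) := con (- 1ℚ) :* (x :* y)) refl
    sign : ∀ n → sgn n * (1ℚ * shift (pole (suc p) z) n) ≡ - 1ℚ * shift (pole⁻ (suc p) z) n
    sign zero    = refl
    sign (suc n) = trans (cong (_* (1ℚ * pole (suc p) z n)) (sgn-suc n)) (neg (sgn n) (pole (suc p) z n))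

  -- A pole of order 0 is the constant series 1.
  pole₀-suc : ∀ x n → pole 0 x (suc n) ≡ 0ℚ
  pole₀-suc x n = trans (cong (λ k → (+ k / 1) * x ^ suc n) (k>n⇒nCk≡0 (ℕP.n<1+n n)))
    (*-zeroˡ (x ^ suc n))

  pole⁻₀-suc : ∀ x n → pole⁻ 0 x (suc n) ≡ 0ℚ
  pole⁻₀-suc x n = trans (cong (sgn (suc n) *_) (pole₀-suc x n)) (*-zeroʳ (sgn (suc n)))

  -- The residue identity, by induction on the orders of the poles

  module _ {X Y Z x y z : ℚ} (Y+Z : Y + Z ≡ X)
           (Xx : X * x ≡ 1ℚ) (Yy : Y * y ≡ 1ℚ) (Zz : Z * z ≡ 1ℚ) (q : ℕ) where

    -- The residues of t⁻ᵐ (X - t)⁻ᵖ (Y - t)^(-q-1) at t = 0, X and Y add up to 0.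
    Residues : ℕ → ℕ → Set
    Residues m p =
      shift (pole p x ⋆ pole (suc q) y) m - sgn (suc q) * shift (pole m x ⋆ pole (suc q) z) p ≡
      (pole m y ⋆ pole⁻ p z) q

    -- Both sides are multiplied by X = Y + Z. On the left X lowers the order of the pole at x in
    -- each convolution; on the right Y and Z each lower one of the two orders. Either side times X
    -- is thus the sum of the same sides for (m , p + 1) and (m + 1 , p).
    residues-step : ∀ m p → Residues m (suc p) → Residues (suc m) p → Residues (suc m) (suc p)
    residues-step m p ih₁ ih₂ = begin
      A - s * B                 ≡⟨ trans (sym (*-identityˡ (A - s * B))) (cong (_* (A - s * B)) (sym Xx)) ⟩
      (X * x) * (A - s * B)     ≡⟨ rearrange X x A s B ⟩
      x * (X * A - s * (X * B)) ≡⟨ cong₂ (λ u v → x * (u - s * v))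
           (Divides-⋆ X 1ℚ (pole (suc p) x) (pole p x) (pole-divides X x Xx p) (pole (suc q) y) m)
           (Divides-⋆ X 1ℚ (pole (suc m) x) (pole m x) (pole-divides X x Xx m) (pole (suc q) z) p) ⟩
      -- `A₁` and `B₂` belong to the orders (m , p + 1), `A₂` and `B₁` to (m + 1 , p).
      x * ((1ℚ * A₁ + A₂) - s * (1ℚ * B₁ + B₂)) ≡⟨ regroup x A₁ A₂ s B₁ B₂ ⟩
      x * ((A₁ - s * B₂) + (A₂ - s * B₁))       ≡⟨ cong₂ (λ u v → x * (u + v)) ih₁ ih₂ ⟩
      -- Both divisions on the right produce the shifted term `K`, with σ = 1 for Y and σ = -1 for
      -- Z, so that it cancels.
      x * (C₁ + C₂)                             ≡⟨ cancel x K C₁ C₂ ⟩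
      x * ((1ℚ * K + C₁) + (- 1ℚ * K + C₂))     ≡⟨ cong₂ (λ u v → x * (u + v))
           (Divides-⋆ Y 1ℚ (pole (suc m) y) (pole m y) (pole-divides Y y Yy m) (pole⁻ (suc p) z) q)
           (Divides-⋆ʳ Z (- 1ℚ) (pole⁻ (suc p) z) (pole⁻ p z) (pole⁻-divides Z z Zz p) (pole (suc m) y) q) ⟨
      x * (Y * C + Z * C)                       ≡⟨ factor x Y Z C ⟩
      ((Y + Z) * x) * C                         ≡⟨ cong (λ u → u * x * C) Y+Z ⟩
      (X * x) * C                               ≡⟨ trans (cong (_* C) Xx) (*-identityˡ C) ⟩
      C ∎
      where
      s = sgn (suc q)
      A = (pole (suc p) x ⋆ pole (suc q) y) m
      B = (pole (suc m) x ⋆ pole (suc q) z) p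
      C = (pole (suc m) y ⋆ pole⁻ (suc p) z) q
      A₁ = shift (pole (suc p) x ⋆ pole (suc q) y) m
      A₂ = (pole p x ⋆ pole (suc q) y) m
      B₁ = shift (pole (suc m) x ⋆ pole (suc q) z) p
      B₂ = (pole m x ⋆ pole (suc q) z) p
      C₁ = (pole m y ⋆ pole⁻ (suc p) z) q
      C₂ = (pole (suc m) y ⋆ pole⁻ p z) q
      K  = shift (pole (suc m) y ⋆ pole⁻ (suc p) z) q
      rearrange : ∀ X x A s B → (X * x) * (A - s * B) ≡ x * (X * A - s * (X * B))
      rearrange = solve 5 (λ X x A s B →
        (X :* x) :* (A :- s :* B) := x :* (X :* A :- s :* (X :* B))) refl
      regroup : ∀ x A₁ A₂ s B₁ B₂ →
        x * ((1ℚ * A₁ + A₂) - s * (1ℚ * B₁ + B₂)) ≡ x * ((A₁ - s * B₂) + (A₂ - s * B₁))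
      regroup = solve 6 (λ x A₁ A₂ s B₁ B₂ →
        x :* ((con 1ℚ :* A₁ :+ A₂) :- s :* (con 1ℚ :* B₁ :+ B₂)) :=
        x :* ((A₁ :- s :* B₂) :+ (A₂ :- s :* B₁))) refl
      cancel : ∀ x K C₁ C₂ → x * (C₁ + C₂) ≡ x * ((1ℚ * K + C₁) + (- 1ℚ * K + C₂))
      cancel = solve 4 (λ x K C₁ C₂ →
        x :* (C₁ :+ C₂) := x :* ((con 1ℚ :* K :+ C₁) :+ (con (- 1ℚ) :* K :+ C₂))) refl
      factor : ∀ x Y Z C → x * (Y * C + Z * C) ≡ ((Y + Z) * x) * C
      factor = solve 4 (λ x Y Z C → x :* (Y :* C :+ Z :* C) := ((Y :+ Z) :* x) :* C) refl

    -- There is no pole at t = 0, so the first residue vanishes. As `pole 0` is the series 1, each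
    -- of the other two is a single coefficient, and `pole-comm` matches them.
    residues-zeroˡ : ∀ p → Residues 0 (suc p)
    residues-zeroˡ p = begin
      0ℚ - sgn (suc q) * (pole 0 x ⋆ pole (suc q) z) p
        ≡⟨ cong₂ (λ u v → 0ℚ - u * v) (sgn-suc q)
             (⋆-identityˡ {pole 0 x} (pole (suc q) z) refl (pole₀-suc x) p) ⟩
      0ℚ - (- sgn q) * pole (suc q) z p   ≡⟨ negate (sgn q) (pole (suc q) z p) ⟩
      sgn q * pole (suc q) z p            ≡⟨ cong (sgn q *_) (pole-comm q p z) ⟩
      pole⁻ (suc p) z q                    ≡⟨ ⋆-identityˡ {pole 0 y} (pole⁻ (suc p) z) refl (pole₀-suc y) q ⟨
      (pole 0 y ⋆ pole⁻ (suc p) z) q ∎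
      where
      negate : ∀ u v → 0ℚ - (- u) * v ≡ u * v
      negate = solve 2 (λ u v → con 0ℚ :- (:- u) :* v := u :* v) refl

    -- The same with no pole at t = X.
    residues-zeroʳ : ∀ m → Residues (suc m) 0
    residues-zeroʳ m = begin
      (pole 0 x ⋆ pole (suc q) y) m - sgn (suc q) * 0ℚ
        ≡⟨ cong (_- sgn (suc q) * 0ℚ) (⋆-identityˡ {pole 0 x} (pole (suc q) y) refl (pole₀-suc x) m) ⟩
      pole (suc q) y m - sgn (suc q) * 0ℚ   ≡⟨ drop (pole (suc q) y m) (sgn (suc q)) ⟩
      pole (suc q) y m                      ≡⟨ pole-comm q m y ⟩
      pole (suc m) y q                      ≡⟨ ⋆-identityˡ {pole⁻ 0 z} (pole (suc m) y) refl (pole⁻₀-suc z) q ⟨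
      (pole⁻ 0 z ⋆ pole (suc m) y) q            ≡⟨ ⋆-comm (pole⁻ 0 z) (pole (suc m) y) q ⟩
      (pole (suc m) y ⋆ pole⁻ 0 z) q ∎
      where
      drop : ∀ u v → u - v * 0ℚ ≡ u
      drop = solve 2 (λ u v → u :- v :* con 0ℚ := u) refl

    -- The second order is kept positive because the identity fails for both orders 0 when `q` is 0:
    -- the simple pole at Y is then alone.
    residues : ∀ m p → Residues m (suc p)
    residues zero    p       = residues-zeroˡ p
    residues (suc m) zero    = residues-step m zero (residues m zero) (residues-zeroʳ m)
    residues (suc m) (suc p) = residues-step m (suc p) (residues m (suc p)) (residues (suc m) p)

  -- Sums over the triangle Y + Z ≤ N

  sumBelow-cong : ∀ N {f g} → (∀ n → f n ≡ g n) → sumBelow N f ≡ sumBelow N g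
  sumBelow-cong zero    f≡g = refl
  sumBelow-cong (suc N) f≡g = cong₂ _+_ (sumBelow-cong N f≡g) (f≡g N)

  sumBelow-+ : ∀ N f g → sumBelow N (λ n → f n + g n) ≡ sumBelow N f + sumBelow N g
  sumBelow-+ zero    f g = refl
  sumBelow-+ (suc N) f g = trans (cong (_+ (f N + g N)) (sumBelow-+ N f g))
    (+-interchange (sumBelow N f) (sumBelow N g) (f N) (g N))

  sumBelow-* : ∀ N c f → sumBelow N (λ n → c * f n) ≡ c * sumBelow N f
  sumBelow-* zero    c f = sym (*-zeroʳ c)
  sumBelow-* (suc N) c f = trans (cong (_+ c * f N) (sumBelow-* N c f))
    (sym (*-distribˡ-+ c (sumBelow N f) (f N)))

  sumBelow-head : ∀ N f → sumBelow (suc N) f ≡ f 0 + sumBelow N (λ n → f (suc n))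
  sumBelow-head zero    f = +-comm 0ℚ (f 0)
  sumBelow-head (suc N) f = trans (cong (_+ f (suc N)) (sumBelow-head N f))
    (+-assoc (f 0) (sumBelow N (λ n → f (suc n))) (f (suc N)))

  sumBelow-nonNeg : ∀ N {f} → (∀ n → 0ℚ ≤ f n) → 0ℚ ≤ sumBelow N f
  sumBelow-nonNeg zero    0≤f = ≤-refl
  sumBelow-nonNeg (suc N) {f} 0≤f = 0≤+ {sumBelow N f} (sumBelow-nonNeg N 0≤f) (0≤f N)

  sumBelow-≤ : ∀ {f M N} → (∀ n → 0ℚ ≤ f n) → M ℕ.≤ N → sumBelow M f ≤ sumBelow N f
  sumBelow-≤ {f} 0≤f = increasing (λ n → sumBelow n f) λ n → p≤p+q {sumBelow n f} (0≤f n)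

  ∑-proj₁ : ∀ n f → ∑ n (λ i j → f i) ≡ sumBelow (suc n) f
  ∑-proj₁ zero    f = sym (+-identityˡ (f 0))
  ∑-proj₁ (suc n) f = trans (∑-init n (λ i j → f i)) (cong (_+ f (suc n)) (∑-proj₁ n f))

  -- Index n stands for X = n + 1. With Y = r + 1 and Z = s + 1, the equation Y + Z = X becomes r +
  -- s = n - 1, which has no solution for n = 0.
  diagonal : (ℕ → ℕ → ℚ) → ℕ → ℚ
  diagonal f zero    = 0ℚ
  diagonal f (suc n) = ∑ n f

  -- The sum of f r s over all r, s ≥ 0 with (r + 1) + (s + 1) ≤ N.
  △ : ℕ → (ℕ → ℕ → ℚ) → ℚ
  △ N f = sumBelow N (diagonal f)

  △-cong : ∀ N {f g} → (∀ r s → f r s ≡ g r s) → △ N f ≡ △ N g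
  △-cong N {f} {g} f≡g = sumBelow-cong N λ where
    zero    → refl
    (suc n) → ∑-cong n λ r s _ → f≡g r s

  △-+ : ∀ N f g → △ N (λ r s → f r s + g r s) ≡ △ N f + △ N g
  △-+ N f g = trans
    (sumBelow-cong N λ where
      zero    → refl
      (suc n) → ∑-+ n f g)
    (sumBelow-+ N (diagonal f) (diagonal g))

  △-* : ∀ N c f → △ N (λ r s → c * f r s) ≡ c * △ N f
  △-* N c f = trans
    (sumBelow-cong N λ where
      zero    → sym (*-zeroʳ c)
      (suc n) → ∑-* n c f)
    (sumBelow-* N c (diagonal f))

  △-∑ : ∀ N n (f : ℕ → ℕ → ℕ → ℕ → ℚ) →
        △ N (λ r s → ∑ n (λ i j → f i j r s)) ≡ ∑ n (λ i j → △ N (f i j))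
  △-∑ N zero    f = refl
  △-∑ N (suc n) f = trans
    (△-+ N (f 0 (suc n)) (λ r s → ∑ n (λ i j → f (suc i) j r s)))
    (cong (λ t → △ N (f 0 (suc n)) + t) (△-∑ N n (λ i j → f (suc i) j)))

  △-comm : ∀ N f → △ N f ≡ △ N (λ r s → f s r)
  △-comm N f = sumBelow-cong N λ where
    zero    → refl
    (suc n) → ∑-comm n f

  -- The outer sum is moved inside the triangle, so that an identity at each point (r , s) suffices.
  ∑-*-△ : ∀ n N (k : ℕ → ℕ → ℚ) {v : ℕ → ℕ → ℚ} {f : ℕ → ℕ → ℕ → ℕ → ℚ} {h} →
          (∀ i j → v i j ≡ △ N (f i j)) →
          (∀ r s → ∑ n (λ i j → k i j * f i j r s) ≡ h r s) →
          ∑ n (λ i j → k i j * v i j) ≡ △ N h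
  ∑-*-△ n N k {v} {f} {h} v≡△f kf≡h = begin
    ∑ n (λ i j → k i j * v i j)
      ≡⟨ ∑-cong n (λ i j _ → trans (cong (k i j *_) (v≡△f i j)) (sym (△-* N (k i j) (f i j)))) ⟩
    ∑ n (λ i j → △ N (λ r s → k i j * f i j r s))
      ≡⟨ △-∑ N n (λ i j r s → k i j * f i j r s) ⟨
    △ N (λ r s → ∑ n (λ i j → k i j * f i j r s))
      ≡⟨ △-cong N kf≡h ⟩
    △ N h ∎

  -- Sequences tending to 0

  Null : (ℕ → ℚ) → Set
  Null s = ∀ ε → 0ℚ < ε → ∃ λ N → ∀ n → N ℕ.≤ n → ∣ s n ∣ < ε

  Null-cong : ∀ {s t} → (∀ n → s n ≡ t n) → Null s → Null t
  Null-cong s≡t s→0 ε 0<ε =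
    let N , h = s→0 ε 0<ε in N , λ n N≤n → subst (λ p → ∣ p ∣ < ε) (s≡t n) (h n N≤n)

  IsCauchy-cong : ∀ {s t} → (∀ n → s n ≡ t n) → IsCauchy s → IsCauchy t
  IsCauchy-cong s≡t cauchy ε 0<ε =
    let N , h = cauchy ε 0<ε in N , λ m n N≤m N≤n →
      subst₂ (λ p q → ∣ p - q ∣ < ε) (s≡t m) (s≡t n) (h m n N≤m N≤n)

  Null-+ : ∀ s t → Null s → Null t → Null (λ n → s n + t n)
  Null-+ s t s→0 t→0 ε 0<ε =
    let
      δ , 0<δ , δ+δ≡ε = halve ε 0<ε
      M , hs = s→0 δ 0<δ
      N , ht = t→0 δ 0<δ
    in M ℕ.⊔ N , λ n l → subst (∣ s n + t n ∣ <_) δ+δ≡ε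
      (≤-<-trans (∣p+q∣≤∣p∣+∣q∣ (s n) (t n))
        (+-mono-< (hs n (ℕP.m⊔n≤o⇒m≤o M N l)) (ht n (ℕP.m⊔n≤o⇒n≤o M N l))))

  Null-* : ∀ c s → Null s → Null (λ n → c * s n)
  Null-* c s s→0 ε 0<ε =
    let
      -- The bound `1ℚ + ∣ c ∣` is positive even if c = 0, so it can be divided by.
      δ , 0<δ , bδ≡ε = divide (1ℚ + ∣ c ∣) ε 0<b 0<ε
      N , h = s→0 δ 0<δ
    in N , λ n l → subst₂ _<_ (sym (∣p*q∣≡∣p∣*∣q∣ c (s n))) bδ≡ε
      (≤-<-trans (*-monoʳ {∣ s n ∣} (0≤∣p∣ (s n)) ∣c∣≤b)
        (*-monoʳ-<-pos (1ℚ + ∣ c ∣) {{positive 0<b}} (h n l)))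
    where
    0<b : 0ℚ < 1ℚ + ∣ c ∣
    0<b = <-≤-trans (positive⁻¹ 1ℚ) (p≤p+q {1ℚ} (0≤∣p∣ c))
    ∣c∣≤b : ∣ c ∣ ≤ 1ℚ + ∣ c ∣
    ∣c∣≤b = subst (∣ c ∣ ≤_) (+-comm ∣ c ∣ 1ℚ) (p≤p+q {∣ c ∣} 0≤1)

  Null-∑ : ∀ n (f : ℕ → ℕ → ℕ → ℚ) → (∀ i j → Null (f i j)) →
           Null (λ N → ∑ n (λ i j → f i j N))
  Null-∑ zero    f f→0 = f→0 0 0
  Null-∑ (suc n) f f→0 = Null-+ (f 0 (suc n)) (λ N → ∑ n (λ i j → f (suc i) j N))
    (f→0 0 (suc n)) (Null-∑ n (λ i j → f (suc i) j) λ i j → f→0 (suc i) j)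

  -- Comparison of the triangle with squares

  -- Row i of the triangle has N - i entries. In the induction, the new antidiagonal r + s = N
  -- lengthens each row by one.
  △-rows : ∀ (f g : ℕ → ℚ) N → △ (suc N) (λ r s → f r * g s) ≡ ∑ N (λ i n → f i * sumBelow n g)
  △-rows f g zero    = trans (+-identityˡ 0ℚ) (sym (*-zeroʳ (f 0)))
  △-rows f g (suc N) = begin
    △ (suc N) (λ r s → f r * g s) + ∑ N (λ i n → f i * g n)
      ≡⟨ cong (_+ ∑ N (λ i n → f i * g n)) (△-rows f g N) ⟩
    ∑ N (λ i n → f i * sumBelow n g) + ∑ N (λ i n → f i * g n)
      ≡⟨ ∑-+ N (λ i n → f i * sumBelow n g) (λ i n → f i * g n) ⟨
    ∑ N (λ i n → f i * sumBelow n g + f i * g n)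
      ≡⟨ ∑-cong N (λ i n _ → sym (*-distribˡ-+ (f i) (sumBelow n g) (g n))) ⟩
    ∑ N (λ i n → f i * sumBelow (suc n) g)
      -- The row i = N + 1 of the larger triangle is still empty.
      ≡⟨ trans (cong (λ t → ∑ N (λ i n → f i * sumBelow (suc n) g) + t) (*-zeroʳ (f (suc N)))) (+-identityʳ _) ⟨
    ∑ N (λ i n → f i * sumBelow (suc n) g) + f (suc N) * 0ℚ
      ≡⟨ ∑-init N (λ i n → f i * sumBelow n g) ⟨
    ∑ (suc N) (λ i n → f i * sumBelow n g) ∎

  -- Each of the first M rows has length at least K, and the remaining rows are nonnegative. The
  -- induction removes the first row.
  rectangle≤rows : ∀ f g → (∀ n → 0ℚ ≤ f n) → (∀ n → 0ℚ ≤ g n) → ∀ M K →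
    sumBelow M f * sumBelow K g ≤ ∑ (M ℕ.+ K) (λ i n → f i * sumBelow n g)
  rectangle≤rows f g 0≤f 0≤g zero K = ≤-trans
    (≤-reflexive (*-zeroˡ (sumBelow K g)))
    (∑-nonNeg K λ i n → 0≤* {f i} (0≤f i) (sumBelow-nonNeg n 0≤g))
  rectangle≤rows f g 0≤f 0≤g (suc M) K = ≤-trans
    (≤-reflexive (trans (cong (_* sumBelow K g) (sumBelow-head M f))
      (*-distribʳ-+ (sumBelow K g) (f 0) (sumBelow M (λ n → f (suc n))))))
    (+-mono-≤
      (*-monoˡ {f 0} (0≤f 0) (sumBelow-≤ 0≤g (ℕP.≤-trans (ℕP.m≤n+m K M) (ℕP.n≤1+n (M ℕ.+ K)))))
      (rectangle≤rows (λ n → f (suc n)) g (λ n → 0≤f (suc n)) 0≤g M K))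

  -- Every row of the triangle is part of a full row of the square.
  △≤square : ∀ f g → (∀ n → 0ℚ ≤ f n) → (∀ n → 0ℚ ≤ g n) → ∀ N →
    △ (suc N) (λ r s → f r * g s) ≤ sumBelow (suc N) f * sumBelow (suc N) g
  △≤square f g 0≤f 0≤g N = subst₂ _≤_ (sym (△-rows f g N))
    (trans (∑-* N G (λ i n → f i))
      (trans (cong (G *_) (∑-proj₁ N f)) (*-comm G (sumBelow (suc N) f))))
    (∑-mono-≤ N λ i n i+n≡N → ≤-trans
      (*-monoˡ {f i} (0≤f i) (sumBelow-≤ 0≤g (ℕP.≤-trans (ℕP.m≤n+m n i)
        (ℕP.≤-trans (ℕP.≤-reflexive i+n≡N) (ℕP.n≤1+n N)))))
      (≤-reflexive (*-comm (f i) G)))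
    where
    G = sumBelow (suc N) g

  -- The triangle lies between the squares of side ⌊N/2⌋ and N.
  △-square-null : ∀ f g → (∀ n → 0ℚ ≤ f n) → (∀ n → 0ℚ ≤ g n) →
    IsCauchy (λ N → sumBelow N f * sumBelow N g) →
    Null (λ N → △ N (λ r s → f r * g s) - sumBelow N f * sumBelow N g)
  △-square-null f g 0≤f 0≤g cauchy ε 0<ε =
    let M , h = cauchy ε 0<ε in
    -- For 2M ≤ n the square of side M fits into the triangle, so the gap is at most the difference
    -- of two squares of side at least M, which is below ε by the choice of M.
    suc (M ℕ.+ M) , λ where
      (suc n) (ℕ.s≤s M+M≤n) → subst (_< ε)
        (∣p-q∣≡∣q-p∣ (□ (suc n)) (▹ (suc n)))
        (≤-<-trans (gap M n M+M≤n)
          (h (suc n) M (ℕP.≤-trans (ℕP.m≤m+n M M) (ℕP.≤-trans M+M≤n (ℕP.n≤1+n n))) ℕP.≤-refl))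
    where
    □ ▹ : ℕ → ℚ
    □ N = sumBelow N f * sumBelow N g
    ▹ N = △ N (λ r s → f r * g s)

    □≤▹ : ∀ M n → M ℕ.+ M ℕ.≤ n → □ M ≤ ▹ (suc n)
    □≤▹ M n M+M≤n = ≤-trans
      (*-monoˡ {sumBelow M f} (sumBelow-nonNeg M 0≤f) (sumBelow-≤ 0≤g M≤n∸M))
      (≤-trans (rectangle≤rows f g 0≤f 0≤g M (n ℕ.∸ M))
        (≤-reflexive (trans
          (cong (λ k → ∑ k (λ i n → f i * sumBelow n g)) (ℕP.m+[n∸m]≡n M≤n))
          (sym (△-rows f g n)))))
      where
      M≤n : M ℕ.≤ n
      M≤n = ℕP.≤-trans (ℕP.m≤m+n M M) M+M≤n
      M≤n∸M : M ℕ.≤ n ℕ.∸ M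
      M≤n∸M = subst (ℕ._≤ n ℕ.∸ M) (ℕP.m+n∸n≡m M M) (ℕP.∸-monoˡ-≤ M M+M≤n)

    gap : ∀ M n → M ℕ.+ M ℕ.≤ n → ∣ □ (suc n) - ▹ (suc n) ∣ ≤ ∣ □ (suc n) - □ M ∣
    gap M n M+M≤n = subst₂ _≤_
      (sym (0≤p⇒∣p∣≡p (0≤q-p ▹≤□)))
      (sym (0≤p⇒∣p∣≡p (0≤q-p (≤-trans (□≤▹ M n M+M≤n) ▹≤□))))
      (+-monoʳ-≤ (□ (suc n)) (neg-antimono-≤ (□≤▹ M n M+M≤n)))
      where
      ▹≤□ : ▹ (suc n) ≤ □ (suc n)
      ▹≤□ = △≤square f g 0≤f 0≤g n

  -- Truncated sums as sums over the triangle

  /-cong-≡ : ∀ a b c d .{{_ : NonZero b}} .{{_ : NonZero d}} →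
             a ℕ.* d ≡ c ℕ.* b → + a / b ≡ + c / d
  /-cong-≡ a b c d eq = ≤-antisym
    (/-mono-≤ a b c d (ℕP.≤-reflexive eq)) (/-mono-≤ c d a b (ℕP.≤-reflexive (sym eq)))

  u^ : ∀ n k → _/_ (+ 1) (suc n ℕ.^ k) {{ℕP.m^n≢0 (suc n) k}} ≡ u n ^ k
  u^ n zero    = refl
  u^ n (suc k) = trans
    (sym (/-*-/ 1 (suc n) 1 (suc n ℕ.^ k) {{_}} {{n^k≢0}} {{ℕP.m^n≢0 (suc n) (suc k)}}))
    (cong (u n *_) (u^ n k))
    where n^k≢0 = ℕP.m^n≢0 (suc n) k

  -- The trailing 1 is the empty sum left at depth one by the definition of truncated.
  inner : Weight → ℕ → ℕ → ℚ
  inner w k n = term w 1 k n * 1ℚ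

  0≤inner : ∀ w k n → 0ℚ ≤ inner w k n
  0≤inner w k n = 0≤* {term w 1 k n} (0≤term w 1 k n) 0≤1

  term-^ : ∀ w r k n → term w r k n ≡ (+ w r (suc n) / 1) * u n ^ k
  term-^ w r k n = trans
    (trans
      (/-cong-≡ v D (v ℕ.* 1) (1 ℕ.* D) {{D≢0}} {{D≢0′}}
        (trans (cong (v ℕ.*_) (ℕP.*-identityˡ D)) (cong (ℕ._* D) (sym (ℕP.*-identityʳ v)))))
      (sym (/-*-/ v 1 1 D {{_}} {{D≢0}} {{D≢0′}})))
    (cong ((+ v / 1) *_) (u^ n k))
    where
    v = w r (suc n)
    D = suc n ℕ.^ k
    D≢0 : NonZero D
    D≢0 = ℕP.m^n≢0 (suc n) k
    D≢0′ : NonZero (1 ℕ.* D)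
    D≢0′ = ℕP.m*n≢0 1 D {{_}} {{D≢0}}

  inner-^ : ∀ w k n → inner w k n ≡ (+ w 1 (suc n) / 1) * u n ^ k
  inner-^ w k n = trans (*-identityʳ (term w 1 k n)) (term-^ w 1 k n)

  -- An inner variable Y = r + 1 below X = n + 1 determines Z = X - Y = s + 1, so the inner sum runs
  -- over an antidiagonal.
  truncated-diagonal : ∀ w k l n →
    term w 2 k n * truncated w (l ∷ []) n ≡
    diagonal (λ r s → term w 2 k (suc (r ℕ.+ s)) * inner w l r) n
  truncated-diagonal w k l zero    = *-zeroʳ (term w 2 k 0)
  truncated-diagonal w k l (suc n) = begin
    t * sumBelow (suc n) (inner w l)      ≡⟨ cong (t *_) (∑-proj₁ n (inner w l)) ⟨
    t * ∑ n (λ r s → inner w l r)         ≡⟨ ∑-* n t (λ r s → inner w l r) ⟨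
    ∑ n (λ r s → t * inner w l r)
      ≡⟨ ∑-cong n (λ r s r+s≡n → cong (λ e → term w 2 k (suc e) * inner w l r) (sym r+s≡n)) ⟩
    ∑ n (λ r s → term w 2 k (suc (r ℕ.+ s)) * inner w l r) ∎
    where t = term w 2 k (suc n)

  truncated-△ˡ : ∀ w k l N → truncated w (k ∷ l ∷ []) N ≡
    △ N (λ r s → term w 2 k (suc (r ℕ.+ s)) * inner w l r)
  truncated-△ˡ w k l N = sumBelow-cong N (truncated-diagonal w k l)

  -- Reflecting the triangle makes Z the inner variable, as required by the residue at t = X.
  truncated-△ʳ : ∀ w k l N → truncated w (k ∷ l ∷ []) N ≡
    △ N (λ r s → term w 2 k (suc (r ℕ.+ s)) * inner w l s)
  truncated-△ʳ w k l N = trans (truncated-△ˡ w k l N) (trans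
    (△-comm N (λ r s → term w 2 k (suc (r ℕ.+ s)) * inner w l r))
    (△-cong N λ r s → cong (λ e → term w 2 k (suc e) * inner w l s) (ℕP.+-comm s r)))

  -- The binomial coefficients and powers assemble into coefficients of poles, and the weights,
  -- constant in i and j, factor out.
  weighted-⋆ : ∀ p q x y v₁ v₂ n (f g : ℕ → ℚ) →
    (∀ i → f i ≡ v₁ * x ^ (p ℕ.+ i)) → (∀ j → g j ≡ v₂ * y ^ (q ℕ.+ j)) →
    ∑ n (λ i j → (+ (coeff p i ℕ.* coeff q j) / 1) * (f i * g j)) ≡
    (v₁ * v₂) * (pole p x ⋆ pole q y) n
  weighted-⋆ p q x y v₁ v₂ n f g f≡ g≡ = trans
    (∑-cong n λ i j _ → trans
      (cong₂ _*_ (sym (/-*-/ (coeff p i) 1 (coeff q j) 1)) (cong₂ _*_ (f≡ i) (g≡ j)))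
      (regroup (+ coeff p i / 1) (+ coeff q j / 1) v₁ (x ^ (p ℕ.+ i)) v₂ (y ^ (q ℕ.+ j))))
    (∑-* n (v₁ * v₂) (λ i j → pole p x i * pole q y j))
    where
    regroup : ∀ k l v₁ X v₂ Y → (k * l) * ((v₁ * X) * (v₂ * Y)) ≡ (v₁ * v₂) * ((k * X) * (l * Y))
    regroup = solve 6 (λ k l v₁ X v₂ Y →
      (k :* l) :* ((v₁ :* X) :* (v₂ :* Y)) := (v₁ :* v₂) :* ((k :* X) :* (l :* Y))) refl

  weighted-⋆⁻ : ∀ m p y z v₁ v₂ n (f g : ℕ → ℚ) →
    (∀ i → f i ≡ v₁ * y ^ (m ℕ.+ i)) → (∀ j → g j ≡ v₂ * z ^ (p ℕ.+ j)) →
    ∑ n (λ i j → (sgn j * (+ (coeff m i ℕ.* coeff p j) / 1)) * (f i * g j)) ≡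
    (v₁ * v₂) * (pole m y ⋆ pole⁻ p z) n
  weighted-⋆⁻ m p y z v₁ v₂ n f g f≡ g≡ = trans
    (∑-cong n λ i j _ → trans
      (cong₂ _*_ (cong (sgn j *_) (sym (/-*-/ (coeff m i) 1 (coeff p j) 1))) (cong₂ _*_ (f≡ i) (g≡ j)))
      (regroup (sgn j) (+ coeff m i / 1) (+ coeff p j / 1) v₁ (y ^ (m ℕ.+ i)) v₂ (z ^ (p ℕ.+ j))))
    (∑-* n (v₁ * v₂) (λ i j → pole m y i * pole⁻ p z j))
    where
    regroup : ∀ e k l v₁ X v₂ Y →
      (e * (k * l)) * ((v₁ * X) * (v₂ * Y)) ≡ (v₁ * v₂) * ((k * X) * (e * (l * Y)))
    regroup = solve 7 (λ e k l v₁ X v₂ Y →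
      (e :* (k :* l)) :* ((v₁ :* X) :* (v₂ :* Y)) := (v₁ :* v₂) :* ((k :* X) :* (e :* (l :* Y)))) refl

  -- The instance with the integers r + s + 2 = (r + 1) + (s + 1). The `X` bound here is an index,
  -- one less than the integer it stands for.
  residues-u : ∀ r s q m p → let X = suc (r ℕ.+ s) in
    shift (pole (suc p) (u X) ⋆ pole (suc q) (u r)) m -
      sgn (suc q) * shift (pole m (u X) ⋆ pole (suc q) (u s)) (suc p) ≡
    (pole m (u r) ⋆ pole⁻ (suc p) (u s)) q
  residues-u r s = residues
    {+ suc (suc (r ℕ.+ s)) / 1} {+ suc r / 1} {+ suc s / 1} {u (suc (r ℕ.+ s))} {u r} {u s}
    (trans (/1-+-/1 (suc r) (suc s)) (cong (λ e → + suc e / 1) (ℕP.+-suc r s)))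
    (n*u (suc (r ℕ.+ s))) (n*u r) (n*u s)

  -- The identity for truncated sums and its limit

  seq-∑ : ∀ n f N → seq (∑[i+j= n ] f) N ≡ ∑ n (λ i j → seq (f i j) N)
  seq-∑ zero    f N = refl
  seq-∑ (suc n) f N = cong (λ t → seq (f 0 (suc n)) N + t) (seq-∑ n (λ i j → f (suc i) j) N)

  -- Split w: on a triple X = Y + Z the weight of (X , Y) in a double sum is that of
  -- (Y , Z) in a product of two single sums.
  Split : Weight → Set
  Split w = ∀ r s → w 2 (suc (suc (r ℕ.+ s))) ℕ.* w 1 (suc r) ≡ w 1 (suc r) ℕ.* w 1 (suc s)

  module _ (w : Weight) (split : Split w) where

    W : ℕ → ℕ → ℚ
    W i n = + w i (suc n) / 1

    splitˡ : ∀ r s → W 2 (suc (r ℕ.+ s)) * W 1 r ≡ W 1 r * W 1 s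
    splitˡ r s = begin
      W 2 (suc (r ℕ.+ s)) * W 1 r
        ≡⟨ /-*-/ (w 2 (suc (suc (r ℕ.+ s)))) 1 (w 1 (suc r)) 1 ⟩
      + (w 2 (suc (suc (r ℕ.+ s))) ℕ.* w 1 (suc r)) / 1
        ≡⟨ cong (λ v → + v / 1) (split r s) ⟩
      + (w 1 (suc r) ℕ.* w 1 (suc s)) / 1
        ≡⟨ /-*-/ (w 1 (suc r)) 1 (w 1 (suc s)) 1 ⟨
      W 1 r * W 1 s ∎

    splitʳ : ∀ r s → W 2 (suc (r ℕ.+ s)) * W 1 s ≡ W 1 r * W 1 s
    splitʳ r s = trans (cong (λ e → W 2 (suc e) * W 1 s) (ℕP.+-comm r s))
      (trans (splitˡ s r) (*-comm (W 1 s) (W 1 r)))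

    -- This is exact for every N, being the residue identity summed over the triangle. It differs
    -- from the truncated theorem only in having triangles for products on the right.
    truncated-identity : ∀ p m q .{{_ : NonZero p}} .{{_ : NonZero m}} .{{_ : NonZero q}} N →
      ∑ (m ℕ.∸ 1) (λ i j → (+ (coeff p i ℕ.* coeff q j) / 1) * truncated w (p ℕ.+ i ∷ q ℕ.+ j ∷ []) N)
      - sgn q *
      ∑ (p ℕ.∸ 1) (λ i j → (+ (coeff m i ℕ.* coeff q j) / 1) * truncated w (m ℕ.+ i ∷ q ℕ.+ j ∷ []) N)
      ≡ ∑ (q ℕ.∸ 1) (λ i j → (sgn j * (+ (coeff m i ℕ.* coeff p j) / 1)) *
          △ N (λ r s → inner w (m ℕ.+ i) r * inner w (p ℕ.+ j) s))
    truncated-identity p@(suc p′) m@(suc m′) q@(suc q′) N = begin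
      ∑ m′ (λ i j → (+ (coeff p i ℕ.* coeff q j) / 1) * truncated w (p ℕ.+ i ∷ q ℕ.+ j ∷ []) N) -
      sgn q * ∑ p′ (λ i j → (+ (coeff m i ℕ.* coeff q j) / 1) * truncated w (m ℕ.+ i ∷ q ℕ.+ j ∷ []) N)
        -- The first sum is taken over the pairs (X , Y), the second over (X , Z); by the splitting
        -- of weights both acquire the common weight `Ω`.
        ≡⟨ cong₂ (λ s t → s - sgn q * t)
             (∑-*-△ m′ N (λ i j → + (coeff p i ℕ.* coeff q j) / 1)
               (λ i j → truncated-△ˡ w (p ℕ.+ i) (q ℕ.+ j) N) λ r s → trans
                 (weighted-⋆ p q (x r s) (u r) (W 2 (suc (r ℕ.+ s))) (W 1 r) m′ _ _
                   (λ i → term-^ w 2 (p ℕ.+ i) (suc (r ℕ.+ s))) (λ j → inner-^ w (q ℕ.+ j) r))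
                 (cong (_* A r s) (splitˡ r s)))
             (∑-*-△ p′ N (λ i j → + (coeff m i ℕ.* coeff q j) / 1)
               (λ i j → truncated-△ʳ w (m ℕ.+ i) (q ℕ.+ j) N) λ r s → trans
                 (weighted-⋆ m q (x r s) (u s) (W 2 (suc (r ℕ.+ s))) (W 1 s) p′ _ _
                   (λ i → term-^ w 2 (m ℕ.+ i) (suc (r ℕ.+ s))) (λ j → inner-^ w (q ℕ.+ j) s))
                 (cong (_* B r s) (splitʳ r s))) ⟩
      △ N (λ r s → Ω r s * A r s) - sgn q * △ N (λ r s → Ω r s * B r s)
        ≡⟨ cong (λ t → △ N (λ r s → Ω r s * A r s) + t) (trans
             (neg-* (sgn q) (△ N (λ r s → Ω r s * B r s)))
             (sym (△-* N (- sgn q) (λ r s → Ω r s * B r s)))) ⟩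
      △ N (λ r s → Ω r s * A r s) + △ N (λ r s → - sgn q * (Ω r s * B r s))
        ≡⟨ △-+ N (λ r s → Ω r s * A r s) (λ r s → - sgn q * (Ω r s * B r s)) ⟨
      △ N (λ r s → Ω r s * A r s + - sgn q * (Ω r s * B r s))
        ≡⟨ △-cong N (λ r s → trans (factor (Ω r s) (A r s) (sgn q) (B r s))
             (cong (Ω r s *_) (residues-u r s q′ m p′))) ⟩
      △ N (λ r s → Ω r s * (pole m (u r) ⋆ pole⁻ p (u s)) q′)
        ≡⟨ ∑-*-△ q′ N (λ i j → sgn j * (+ (coeff m i ℕ.* coeff p j) / 1)) (λ i j → refl) (λ r s →
             weighted-⋆⁻ m p (u r) (u s) (W 1 r) (W 1 s) q′ _ _
               (λ i → inner-^ w (m ℕ.+ i) r) (λ j → inner-^ w (p ℕ.+ j) s)) ⟨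
      ∑ q′ (λ i j → (sgn j * (+ (coeff m i ℕ.* coeff p j) / 1)) *
        △ N (λ r s → inner w (m ℕ.+ i) r * inner w (p ℕ.+ j) s)) ∎
      where
      x Ω A B : ℕ → ℕ → ℚ
      x r s = u (suc (r ℕ.+ s))
      Ω r s = W 1 r * W 1 s
      A r s = (pole p (x r s) ⋆ pole q (u r)) m′
      B r s = (pole m (x r s) ⋆ pole q (u s)) p′
      neg-* : ∀ s t → - (s * t) ≡ - s * t
      neg-* = solve 2 (λ s t → :- (s :* t) := :- s :* t) refl
      factor : ∀ o A s B → o * A + - s * (o * B) ≡ o * (A - s * B)
      factor = solve 4 (λ o A s B → o :* A :+ :- s :* (o :* B) := o :* (A :- s :* B)) refl

    -- S is a parameter because comparing real numbers that mention a concrete series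
    -- would unfold their proofs of convergence.
    weighted-identity : (S : ∀ ks → {{Admissible ks}} → ℝ) →
      (∀ ks {{_ : Admissible ks}} N → seq (S ks) N ≡ truncated w ks N) →
      ∀ p m q .{{_ : NonTrivial p}} .{{_ : NonTrivial m}} .{{_ : NonZero q}} →
      ∑[i+j= m ℕ.∸ 1 ] (λ i j → fromℕ (((p ℕ.+ i ℕ.∸ 1) C i) ℕ.* ((q ℕ.+ j ℕ.∸ 1) C j)) *ᴿ
        S (p ℕ.+ i ∷ q ℕ.+ j ∷ []))
      -ᴿ fromℤ (-1ℤ ℤ.^ q) *ᴿ
         ∑[i+j= p ℕ.∸ 1 ] (λ i j → fromℕ (((m ℕ.+ i ℕ.∸ 1) C i) ℕ.* ((q ℕ.+ j ℕ.∸ 1) C j)) *ᴿ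
        S (m ℕ.+ i ∷ q ℕ.+ j ∷ []))
      ≈ ∑[i+j= q ℕ.∸ 1 ] (λ i j →
        fromℤ (-1ℤ ℤ.^ j) *ᴿ fromℕ (((m ℕ.+ i ℕ.∸ 1) C i) ℕ.* ((p ℕ.+ j ℕ.∸ 1) C j)) *ᴿ
        S (m ℕ.+ i ∷ []) *ᴿ S (p ℕ.+ j ∷ []))
    -- Equality of reals is nullity of the difference of their sequences, here a combination of the
    -- gaps between triangles and squares.
    weighted-identity S seq-S p m q = Null-cong (λ N → sym (difference N))
      (Null-∑ (q ℕ.∸ 1) (λ i j N → k i j * (△S i j N - □S i j N)) λ i j →
        Null-* (k i j) (λ N → △S i j N - □S i j N)
          (△-square-null (inner w (m ℕ.+ i)) (inner w (p ℕ.+ j))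
            (0≤inner w (m ℕ.+ i)) (0≤inner w (p ℕ.+ j))
            -- The squares form a Cauchy sequence because they are the sequence of a product of two
            -- reals.
            (IsCauchy-cong
              (λ N → cong₂ _*_ (seq-S (m ℕ.+ i ∷ []) N) (seq-S (p ℕ.+ j ∷ []) N))
              (isCauchy (S (m ℕ.+ i ∷ []) *ᴿ S (p ℕ.+ j ∷ []))))))
      where
      k : ℕ → ℕ → ℚ
      k i j = sgn j * (+ (coeff m i ℕ.* coeff p j) / 1)
      △S □S : ℕ → ℕ → ℕ → ℚ
      △S i j N = △ N (λ r s → inner w (m ℕ.+ i) r * inner w (p ℕ.+ j) s)
      □S i j N = sumBelow N (inner w (m ℕ.+ i)) * sumBelow N (inner w (p ℕ.+ j))
      L₁ L₂ D : ℕ → ℕ → ℝ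
      L₁ i j = fromℕ (((p ℕ.+ i ℕ.∸ 1) C i) ℕ.* ((q ℕ.+ j ℕ.∸ 1) C j)) *ᴿ S (p ℕ.+ i ∷ q ℕ.+ j ∷ [])
      L₂ i j = fromℕ (((m ℕ.+ i ℕ.∸ 1) C i) ℕ.* ((q ℕ.+ j ℕ.∸ 1) C j)) *ᴿ S (m ℕ.+ i ∷ q ℕ.+ j ∷ [])
      D i j = fromℤ (-1ℤ ℤ.^ j) *ᴿ fromℕ (((m ℕ.+ i ℕ.∸ 1) C i) ℕ.* ((p ℕ.+ j ℕ.∸ 1) C j)) *ᴿ
        S (m ℕ.+ i ∷ []) *ᴿ S (p ℕ.+ j ∷ [])
      *-- : ∀ x y z → x * y - x * z ≡ x * (y - z)
      *-- = solve 3 (λ x y z → x :* y :- x :* z := x :* (y :- z)) refl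
      difference : ∀ N →
        seq (∑[i+j= m ℕ.∸ 1 ] L₁ -ᴿ fromℤ (-1ℤ ℤ.^ q) *ᴿ ∑[i+j= p ℕ.∸ 1 ] L₂) N
          - seq (∑[i+j= q ℕ.∸ 1 ] D) N ≡
        ∑ (q ℕ.∸ 1) (λ i j → k i j * (△S i j N - □S i j N))
      difference N = begin
        (seq (∑[i+j= m ℕ.∸ 1 ] L₁) N - sgn q * seq (∑[i+j= p ℕ.∸ 1 ] L₂) N)
          - seq (∑[i+j= q ℕ.∸ 1 ] D) N
          ≡⟨ cong₂ _-_
               (trans
                 (cong₂ (λ s t → s - sgn q * t)
                   (trans (seq-∑ (m ℕ.∸ 1) L₁ N) (∑-cong (m ℕ.∸ 1) λ i j _ →
                     cong ((+ (coeff p i ℕ.* coeff q j) / 1) *_)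
                       (seq-S (p ℕ.+ i ∷ q ℕ.+ j ∷ []) N)))
                   (trans (seq-∑ (p ℕ.∸ 1) L₂ N) (∑-cong (p ℕ.∸ 1) λ i j _ →
                     cong ((+ (coeff m i ℕ.* coeff q j) / 1) *_)
                       (seq-S (m ℕ.+ i ∷ q ℕ.+ j ∷ []) N))))
                 (truncated-identity p m q {{nonTrivial⇒nonZero p}} {{nonTrivial⇒nonZero m}} N))
               (trans (seq-∑ (q ℕ.∸ 1) D N) (∑-cong (q ℕ.∸ 1) λ i j _ → trans
                 (cong₂ (λ s t → k i j * s * t) (seq-S (m ℕ.+ i ∷ []) N) (seq-S (p ℕ.+ j ∷ []) N))
                 (*-assoc (k i j) (sumBelow N (inner w (m ℕ.+ i))) (sumBelow N (inner w (p ℕ.+ j)))))) ⟩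
        ∑ (q ℕ.∸ 1) (λ i j → k i j * △S i j N) - ∑ (q ℕ.∸ 1) (λ i j → k i j * □S i j N)
          ≡⟨ ∑-- (q ℕ.∸ 1) (λ i j → k i j * △S i j N) (λ i j → k i j * □S i j N) ⟨
        ∑ (q ℕ.∸ 1) (λ i j → k i j * △S i j N - k i j * □S i j N)
          ≡⟨ ∑-cong (q ℕ.∸ 1) (λ i j _ → *-- (k i j) (△S i j N) (□S i j N)) ⟩
        ∑ (q ℕ.∸ 1) (λ i j → k i j * (△S i j N - □S i j N)) ∎

  -- Application to zeta values and T-values

  seq-multipleSum : ∀ w (w≤2 : ∀ r n → w r n ℕ.≤ 2) ks {{_ : Admissible ks}} N →
    seq (multipleSum w w≤2 ks) N ≡ truncated w ks N
  -- `multipleSum` unfolds only once the instance is matched as `admissible`.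
  seq-multipleSum w w≤2 (k ∷ ks) {{admissible}} N = refl

  -- The weights depend only on parities, and remainders modulo 2 compute past two successors, so
  -- the cases r, s < 2 decide.
  T-split : Split T-weight
  T-split zero          zero          = refl
  T-split zero          (suc zero)    = refl
  T-split zero          (suc (suc s)) = T-split zero s
  T-split (suc zero)    zero          = refl
  T-split (suc zero)    (suc zero)    = refl
  T-split (suc zero)    (suc (suc s)) = T-split (suc zero) s
  T-split (suc (suc r)) s             = T-split r s

open import Defs using (fromℕ; fromℤ; _≈_; _+ᴿ_; _-ᴿ_; _*ᴿ_; ∑[i+j=_]; ζ; T)
open import Data.Integer.Base using (-1ℤ) renaming (_^_ to _^ℤ_)
open import Data.List.Base using ([]; _∷_)
open import Data.Nat.Base using (ℕ; _+_; _*_; _∸_; NonZero; NonTrivial)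
open import Data.Nat.Combinatorics using (_C_)
open import Data.Product.Base using (_×_; _,_)
open import Data.Nat.Base using (z≤n; s≤s)
open import Defs using (ζ-weight; T-weight; T-weight≤2)
open import Relation.Binary.PropositionalEquality using (refl)
open MultipleSums using (weighted-identity; seq-multipleSum; T-split)

theorem3p1 : (p m q : ℕ) → .{{_ : NonTrivial p}} → .{{_ : NonTrivial m}} → .{{_ : NonZero q}} →
    ( ∑[i+j= m ∸ 1 ] (λ i j → fromℕ (((p + i ∸ 1) C i) * ((q + j ∸ 1) C j)) *ᴿ ζ (p + i ∷ q + j ∷ []))
    -ᴿ fromℤ (-1ℤ ^ℤ q) *ᴿ
    ∑[i+j= p ∸ 1 ] (λ i j → fromℕ (((m + i ∸ 1) C i) * ((q + j ∸ 1) C j)) *ᴿ ζ (m + i ∷ q + j ∷ []))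
    ≈ ∑[i+j= q ∸ 1 ] (λ i j → fromℤ (-1ℤ ^ℤ j) *ᴿ fromℕ (((m + i ∸ 1) C i) * ((p + j ∸ 1) C j)) *ᴿ ζ (m + i ∷ []) *ᴿ ζ (p + j ∷ [])) )
    ×
    ( ∑[i+j= m ∸ 1 ] (λ i j → fromℕ (((p + i ∸ 1) C i) * ((q + j ∸ 1) C j)) *ᴿ T (p + i ∷ q + j ∷ []))
    -ᴿ fromℤ (-1ℤ ^ℤ q) *ᴿ
    ∑[i+j= p ∸ 1 ] (λ i j → fromℕ (((m + i ∸ 1) C i) * ((q + j ∸ 1) C j)) *ᴿ T (m + i ∷ q + j ∷ []))
    ≈ ∑[i+j= q ∸ 1 ] (λ i j → fromℤ (-1ℤ ^ℤ j) *ᴿ fromℕ (((m + i ∸ 1) C i) * ((p + j ∸ 1) C j)) *ᴿ T (m + i ∷ []) *ᴿ T (p + j ∷ [])) )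
theorem3p1 p m q {{p>1}} {{m>1}} {{q>0}} =
  -- All weights are 1, so the splitting holds by computation.
  weighted-identity ζ-weight (λ _ _ → refl)
    ζ (λ ks N → seq-multipleSum ζ-weight (λ _ _ → s≤s z≤n) ks N)
    p m q {{p>1}} {{m>1}} {{q>0}} ,
  weighted-identity T-weight T-split
    T (λ ks N → seq-multipleSum T-weight T-weight≤2 ks N)
    p m q {{p>1}} {{m>1}} {{q>0}}
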